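{- Let $K$ be a field and let $\mathcal{P}\subset \mathbb{R}_{\ge 0}^n$ be an anti-blocking lattice polytope of dimension $n$, and let $\mathcal{P}^{\pm}=\{\varepsilon\mathbf{x} : \varepsilon\in\{ -1,1\}^n,\ \mathbf{x}\in\mathcal{P}\}$. Then the toric ideal $I_{\mathcal{P}}$ is generated by quadratic binomials if and only if the toric ideal $I_{\mathcal{P}^{\pm}}$ is generated by quadratic binomials.
   Context: A lattice polytope is a convex polytope whose vertices have integer coordinates. A lattice polytope $\mathcal{P}\subset\mathbb{R}_{\ge0}^n$ of dimension $n$ is anti-blocking if for every $\mathbf{y}\in\mathcal{P}$ and every $\mathbf{x}\in\mathbb{R}^n$ with $0\le x_i\le y_i$ for all $i$, one has $\mathbf{x}\in\mathcal{P}$. For $\varepsilon\in\{ -1,1\}^n$ and $\mathbf{x}\in\mathbb{R}^n$, $\varepsilon\mathbf{x}:=(\varepsilon_1x_1,\dots,\varepsilon_nx_n)$; $\mathcal{P}^{\pm}$ is a convex lattice polytope. For a lattice polytope $\mathcal{Q}\subset\mathbb{R}^n$ with $\mathcal{Q}\cap\mathbb{Z}^n=\{\mathbf{a}_1,\dots,\mathbf{a}_m\}$, the toric ring $K[\mathcal{Q}]$ is the subalgebra of $K[t_1^{\pm1},\dots,t_n^{\pm1},s]$ generated by $\mathbf{t}^{\mathbf{a}_i}s$ ($1\le i\le m$), and the toric ideal $I_{\mathcal{Q}}$ is the kernel of the surjective $K$-algebra homomorphism $K[x_1,\dots,x_m]\to K[\mathcal{Q}]$, $x_i\mapsto \mathbf{t}^{\mathbf{a}_i}s$.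 -}

module Defs where

open import Level using (Level; _⊔_)
open import Data.Bool using (Bool; true; false; if_then_else_; _∧_)
open import Data.Nat as ℕ using (ℕ)
open import Data.Integer as ℤ using (ℤ; +_)
open import Data.Rational as ℚ using (ℚ; 0ℚ; 1ℚ; _/_)
open import Data.Fin using (Fin)
open import Data.Vec as V using (Vec; []; _∷_; lookup; zipWith; replicate)
open import Data.Vec.Properties using (≡-dec)
open import Data.Vec.Relation.Unary.All as VAll using ()
open import Data.Vec.Relation.Binary.Pointwise.Inductive using (Pointwise)
import Data.Vec.Membership.Propositional as VMem
open import Data.List as L using (List; []; _∷_)
open import Data.List.Relation.Unary.All as LAll using ()
import Data.List.Membership.Propositional as LMem
open import Data.Product using (Σ; ∃; _×_; _,_; proj₁; proj₂)
open import Data.Sign using (Sign)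
open import Relation.Nullary using (¬_; does)
open import Relation.Binary.PropositionalEquality using (_≡_)
open import Algebra.Bundles using (CommutativeRing)

record Field (c ℓ : Level) : Set (Level.suc (c ⊔ ℓ)) where
  field
    commutativeRing : CommutativeRing c ℓ
  open CommutativeRing commutativeRing public
  field
    1≉0     : ¬ (1# ≈ 0#)
    inverse : ∀ x → ¬ (x ≈ 0#) → Σ Carrier (λ y → (x * y) ≈ 1#)

-- Rational affine geometry in ℚⁿ (points of the real polytope with
-- rational coordinates).

toℚ : ℤ → ℚ
toℚ z = z / 1

toℚⁿ : ∀ {n} → Vec ℤ n → Vec ℚ n
toℚⁿ = V.map toℚ

sumℚ : ∀ {k} → Vec ℚ k → ℚ
sumℚ v = L.foldr ℚ._+_ 0ℚ (V.toList v)

dot : ∀ {n} → Vec ℚ n → Vec ℚ n → ℚ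
dot c x = sumℚ (zipWith ℚ._*_ c x)

combo : ∀ {n k} → Vec ℚ k → Vec (Vec ℤ n) k → Vec ℚ n
combo {n} ls vs =
  L.foldr (zipWith ℚ._+_) (replicate n 0ℚ)
    (V.toList (zipWith (λ l v → V.map (l ℚ.*_) (toℚⁿ v)) ls vs))

_∈conv_ : ∀ {n k} → Vec ℚ n → Vec (Vec ℤ n) k → Set
_∈conv_ {n} {k} x vs =
  ∃ λ (ls : Vec ℚ k) →
    VAll.All (0ℚ ℚ.≤_) ls × sumℚ ls ≡ 1ℚ × x ≡ combo ls vs

AntiBlocking : ∀ {n k} → Vec (Vec ℤ n) k → Set
AntiBlocking {n} vs =
  (∀ (y : Vec ℚ n) → y ∈conv vs → VAll.All (0ℚ ℚ.≤_) y) ×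
  (∀ (y x : Vec ℚ n) → y ∈conv vs →
     Pointwise (λ xi yi → (0ℚ ℚ.≤ xi) × (xi ℚ.≤ yi)) x y → x ∈conv vs)

-- dim P = n: P is nonempty and its affine hull is all of ℝⁿ, i.e. P is
-- not contained in any affine hyperplane {x | c·x = d} with c ≠ 0.
FullDimensional : ∀ {n k} → Vec (Vec ℤ n) k → Set
FullDimensional {n} vs =
  (∃ λ (x : Vec ℚ n) → x ∈conv vs) ×
  (∀ (c : Vec ℚ n) (d : ℚ) → (∀ x → x ∈conv vs → dot c x ≡ d) →
     VAll.All (_≡ 0ℚ) c)

LatticePointOf : ∀ {n k} → Vec (Vec ℤ n) k → Vec ℤ n → Set
LatticePointOf vs z = toℚⁿ z ∈conv vs

applySigns : ∀ {n} → Vec Sign n → Vec ℤ n → Vec ℤ n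
applySigns = zipWith (λ s z → (s ℤ.◃ 1) ℤ.* z)

-- Lattice points of P^± = {εx | ε ∈ {-1,1}ⁿ, x ∈ P}:
-- z ∈ P^± ∩ ℤⁿ iff εz ∈ P for some ε (ε is an involution).
LatticePointOf± : ∀ {n k} → Vec (Vec ℤ n) k → Vec ℤ n → Set
LatticePointOf± {n} vs z = ∃ λ (ε : Vec Sign n) → toℚⁿ (applySigns ε z) ∈conv vs

Enumerates : ∀ {n m} → (Vec ℤ n → Set) → Vec (Vec ℤ n) m → Set
Enumerates {n} {m} S A =
  (∀ (i j : Fin m) → lookup A i ≡ lookup A j → i ≡ j) ×
  (∀ (z : Vec ℤ n) → (S z → z VMem.∈ A) × (z VMem.∈ A → S z))

module _ {c ℓ} (K : Field c ℓ) where
  open Field K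

  Monomial : ℕ → Set
  Monomial m = Vec ℕ m

  Poly : ℕ → Set c
  Poly m = List (Carrier × Monomial m)

  degree : ∀ {m} → Monomial m → ℕ
  degree α = V.sum α

  coeff : ∀ {m} → Poly m → Monomial m → Carrier
  coeff p α = L.foldr (λ t acc →
      if does (≡-dec ℕ._≟_ (proj₂ t) α) then proj₁ t + acc else acc) 0# p

  _≈ₚ_ : ∀ {m} → Poly m → Poly m → Set ℓ
  p ≈ₚ q = ∀ α → coeff p α ≈ coeff q α

  _*ₚ_ : ∀ {m} → Poly m → Poly m → Poly m
  p *ₚ q = L.concatMap (λ s → L.map (λ t →
      (proj₁ s * proj₁ t , zipWith ℕ._+_ (proj₂ s) (proj₂ t))) q) p

  InIdealGen : ∀ {m} → List (Poly m) → Poly m → Set (c ⊔ ℓ)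
  InIdealGen {m} G p =
    ∃ λ (hgs : List (Poly m × Poly m)) →
      LAll.All (λ hg → proj₂ hg LMem.∈ G) hgs ×
      p ≈ₚ L.concatMap (λ hg → proj₁ hg *ₚ proj₂ hg) hgs

  -- x^α ↦ t^{Σ α_i a_i} s^{|α|}
  exponentImage : ∀ {n m} → Vec (Vec ℤ n) m → Monomial m → Vec ℤ n
  exponentImage {n} A α =
    L.foldr (zipWith ℤ._+_) (replicate n (+ 0))
      (V.toList (zipWith (λ k a → V.map (λ ai → + k ℤ.* ai) a) α A))

  -- coefficient of t^b s^d in the image of p under x_i ↦ t^{a_i} s
  imageCoeff : ∀ {n m} → Vec (Vec ℤ n) m → Poly m → Vec ℤ n → ℕ → Carrier
  imageCoeff A p b d = L.foldr (λ t acc →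
      if does (≡-dec ℤ._≟_ (exponentImage A (proj₂ t)) b)
         ∧ does (degree (proj₂ t) ℕ.≟ d)
      then proj₁ t + acc else acc) 0# p

  InToricIdeal : ∀ {n m} → Vec (Vec ℤ n) m → Poly m → Set ℓ
  InToricIdeal A p = ∀ b d → imageCoeff A p b d ≈ 0#

  IsQuadraticBinomial : ∀ {m} → Poly m → Set c
  IsQuadraticBinomial {m} f =
    ∃ λ (a : Carrier) → ∃ λ (b : Carrier) →
    ∃ λ (u : Monomial m) → ∃ λ (v : Monomial m) →
      degree u ≡ 2 × degree v ≡ 2 × f ≡ (a , u) ∷ (b , v) ∷ []

  GeneratedByQuadraticBinomials : ∀ {n m} → Vec (Vec ℤ n) m → Set (c ⊔ ℓ)
  GeneratedByQuadraticBinomials {n} {m} A =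
    ∃ λ (G : List (Poly m)) →
      LAll.All IsQuadraticBinomial G ×
      LAll.All (InToricIdeal A) G ×
      (∀ p → InToricIdeal A p → InIdealGen G p)

{-# OPTIONS --safe #-}

-- Over any field, the toric ideal of a point configuration is generated by
-- quadratic binomials iff any two multisets of points with the same cardinality
-- and the same sum are joined by moves replacing two points x, y by u, v with
-- x + y = u + v.
-- If the nonnegative configuration has this property, so has the signed one:
-- cancelling opposite signs between pairs of points (a move, since P is
-- anti-blocking) makes each coordinate of a multiset of constant sign, and a
-- reflection then brings two such multisets with the same sum into P.
-- Conversely, cut the positive parts of the points of a signed multiset down to
-- a prescribed nonnegative sum; all ways of cutting are joined by moves inside P,
-- and the resulting class does not change under signed moves.
module Submission where

open import Defs
open import Level using (Level; _⊔_)
open import Data.Bool using (Bool; true; false; if_then_else_; _∧_; not)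
open import Data.Fin as Fin using (Fin)
open import Data.Integer as ℤ using (ℤ; +_; -[1+_]; 0ℤ; ∣_∣; _⊖_; _◃_; sign)
import Data.Integer.Properties as ℤₚ
open import Data.List as List using (List; []; _∷_; _++_; length; foldr; map; concatMap; allFin;
  cartesianProductWith)
open import Data.List.Properties using (length-map; ++-identityʳ; concatMap-++)
open import Data.List.Membership.Propositional using (_∈_)
open import Data.List.Membership.Propositional.Properties
  using (∈-allFin; ∈-cartesianProductWith⁺; ∈-cartesianProductWith⁻; ∈-map⁺)
open import Data.List.Relation.Binary.Permutation.Propositional as Perm
  using (_↭_; prep; ↭-trans; ↭-reflexive)
import Data.List.Relation.Binary.Permutation.Propositional.Properties as Permₚ
open import Data.List.Relation.Binary.Pointwise as Pointwise using (Pointwise; []; _∷_)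
open import Data.List.Relation.Unary.All as All using (All; []; _∷_)
import Data.List.Relation.Unary.All.Properties as Allₚ
open import Data.List.Relation.Unary.Any using (here; there)
open import Data.Nat as ℕ using (ℕ; zero; suc; _≤_; _∸_; _⊓_; z≤n; s≤s)
import Data.Nat.Properties as ℕₚ
open import Data.Product using (Σ; ∃; ∃₂; _×_; _,_; proj₁; proj₂)
open import Data.Rational as ℚ using (0ℚ)
import Data.Rational.Properties as ℚₚ
import Data.Rational.Unnormalised as ℚᵘ
import Data.Rational.Unnormalised.Properties as ℚᵘₚ
open import Data.Sign using (Sign)
open import Data.Sum using (inj₁; inj₂)
open import Data.Vec as Vec using (Vec; []; _∷_; lookup; tabulate; zipWith; replicate)
import Data.Vec.Properties as Vecₚ
import Data.Vec.Membership.Propositional as Mem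
open import Data.Vec.Membership.Propositional.Properties using (∈-lookup)
import Data.Vec.Relation.Unary.All.Properties as VecAllₚ
import Data.Vec.Relation.Unary.Any as Any
import Data.Vec.Relation.Unary.Any.Properties as Anyₚ
import Data.Vec.Relation.Binary.Pointwise.Inductive as VecPointwise
open import Function using (_∘_; id)
open import Relation.Nullary using (Dec; yes; no; does; ¬_; contradiction)
open import Relation.Nullary.Decidable using (dec-true; dec-false; _×-dec_)
open import Relation.Binary.PropositionalEquality hiding (setoid)
import Relation.Binary.Reasoning.Setoid as SetoidReasoning
import Algebra.Properties.CommutativeSemigroup as CommutativeSemigroupProperties
import Algebra.Properties.Ring as RingProperties

-- What shapes the passage from signed to nonnegative points is that z ↦ z⁺ is not additive: the
-- signed move 1, -1 ↦ 0, 0 changes the sum of the positive parts, so a chain of signed moves does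
-- not project to a chain of moves in P. The positive parts therefore serve only as capacities,
-- while the sum to be distributed among them stays fixed along the chain. For a multiset that is
-- already nonnegative the capacities are the points themselves, and cutting to their own sum
-- changes nothing. The algebraic equivalence rests on summing coefficients over sets of monomials.
-- In a monomial multiple of a quadratic binomial of the toric ideal, the coefficients over a class
-- of monomials joined by moves sum to 0; for x^α - x^β with β outside the class of α they sum to 1.
-- Conversely, modulo the quadratic binomials every monomial may be replaced by a chosen one with
-- the same image; the coefficients collected there are those of the image of the polynomial, so
-- they vanish on the toric ideal.

private variable
  n m : ℕ
  X Y : Set

-- Multisets of points and quadratic moves

total : (X → Fin n → ℤ) → List X → Fin n → ℤ
total pt l i = foldr (λ x s → pt x i ℤ.+ s) 0ℤ l

infix 4 _⊢_∼_
infixr 5 _⨾_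

-- Exchanging two neighbours is itself a `move`, as x + y = y + x, so lists serve as multisets
-- without a permutation rule. Points are functions, hence `cons` compares heads coordinatewise.
data _⊢_∼_ {X : Set} {n} (pt : X → Fin n → ℤ) : List X → List X → Set where
  nil   : pt ⊢ [] ∼ []
  cons  : ∀ {x y l l'} → (∀ i → pt x i ≡ pt y i) → pt ⊢ l ∼ l' → pt ⊢ x ∷ l ∼ y ∷ l'
  move  : ∀ {x y u v} l → (∀ i → pt x i ℤ.+ pt y i ≡ pt u i ℤ.+ pt v i) →
          pt ⊢ x ∷ y ∷ l ∼ u ∷ v ∷ l
  _⨾_   : ∀ {l l' l″} → pt ⊢ l ∼ l' → pt ⊢ l' ∼ l″ → pt ⊢ l ∼ l″

Connected : (X → Fin n → ℤ) → Set
Connected pt = ∀ l l' → length l ≡ length l' → (∀ i → total pt l i ≡ total pt l' i) → pt ⊢ l ∼ l'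

module _ {pt : X → Fin n → ℤ} where

  ∼-refl : ∀ l → pt ⊢ l ∼ l
  ∼-refl []      = nil
  ∼-refl (x ∷ l) = cons (λ _ → refl) (∼-refl l)

  ∼-sym : ∀ {l l'} → pt ⊢ l ∼ l' → pt ⊢ l' ∼ l
  ∼-sym nil         = nil
  ∼-sym (cons e p)  = cons (sym ∘ e) (∼-sym p)
  ∼-sym (move l e)  = move l (sym ∘ e)
  ∼-sym (p ⨾ q)    = ∼-sym q ⨾ ∼-sym p

  ∼-swap : ∀ x y l → pt ⊢ x ∷ y ∷ l ∼ y ∷ x ∷ l
  ∼-swap x y l = move l λ i → ℤₚ.+-comm (pt x i) (pt y i)

  ∼-length : ∀ {l l'} → pt ⊢ l ∼ l' → length l ≡ length l'
  ∼-length nil         = refl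
  ∼-length (cons _ p)  = cong suc (∼-length p)
  ∼-length (move _ _)  = refl
  ∼-length (p ⨾ q) = trans (∼-length p) (∼-length q)

  ∼-total : ∀ {l l'} → pt ⊢ l ∼ l' → ∀ i → total pt l i ≡ total pt l' i
  ∼-total nil         i = refl
  ∼-total (cons e p)  i = cong₂ ℤ._+_ (e i) (∼-total p i)
  ∼-total (p ⨾ q) i = trans (∼-total p i) (∼-total q i)
  ∼-total (move {x} {y} {u} {v} l e) i = begin
    pt x i ℤ.+ (pt y i ℤ.+ total pt l i) ≡⟨ ℤₚ.+-assoc (pt x i) (pt y i) _ ⟨
    pt x i ℤ.+ pt y i ℤ.+ total pt l i   ≡⟨ cong (ℤ._+ total pt l i) (e i) ⟩
    pt u i ℤ.+ pt v i ℤ.+ total pt l i   ≡⟨ ℤₚ.+-assoc (pt u i) (pt v i) _ ⟩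
    pt u i ℤ.+ (pt v i ℤ.+ total pt l i) ∎
    where open ≡-Reasoning

module _ {pt : X → Fin n → ℤ} {pt' : Y → Fin n → ℤ} (f : X → Y) (h : Fin n → ℤ → ℤ)
         (f-pt : ∀ x i → pt' (f x) i ≡ h i (pt x i))
         (h-+ : ∀ i a b → h i (a ℤ.+ b) ≡ h i a ℤ.+ h i b) where

  private
    f-+ : ∀ x y i → pt' (f x) i ℤ.+ pt' (f y) i ≡ h i (pt x i ℤ.+ pt y i)
    f-+ x y i = begin
      pt' (f x) i ℤ.+ pt' (f y) i   ≡⟨ cong₂ ℤ._+_ (f-pt x i) (f-pt y i) ⟩
      h i (pt x i) ℤ.+ h i (pt y i) ≡⟨ h-+ i _ _ ⟨
      h i (pt x i ℤ.+ pt y i)       ∎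
      where open ≡-Reasoning

  ∼-map : ∀ {l l'} → pt ⊢ l ∼ l' → pt' ⊢ map f l ∼ map f l'
  ∼-map nil = nil
  ∼-map (cons {x} {y} e p) = cons (λ i → begin
    pt' (f x) i  ≡⟨ f-pt x i ⟩
    h i (pt x i) ≡⟨ cong (h i) (e i) ⟩
    h i (pt y i) ≡⟨ f-pt y i ⟨
    pt' (f y) i  ∎) (∼-map p)
    where open ≡-Reasoning
  ∼-map (move {x} {y} {u} {v} l e) = move (map f l) λ i → begin
    pt' (f x) i ℤ.+ pt' (f y) i ≡⟨ f-+ x y i ⟩
    h i (pt x i ℤ.+ pt y i)     ≡⟨ cong (h i) (e i) ⟩
    h i (pt u i ℤ.+ pt v i)     ≡⟨ f-+ u v i ⟨
    pt' (f u) i ℤ.+ pt' (f v) i ∎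
    where open ≡-Reasoning
  ∼-map (p ⨾ q) = ∼-map p ⨾ ∼-map q

module _ {pt : X → Fin n → ℤ} {pt' : Y → Fin n → ℤ} where

  -- Going there and back keeps only the coordinates, and `cons` absorbs the difference, so `f` and
  -- `g` need not be inverse. This trades indices into an enumeration for points with membership
  -- proofs.
  Connected-transport : (f : X → Y) → (∀ x i → pt' (f x) i ≡ pt x i) →
                        (g : Y → X) → (∀ y i → pt (g y) i ≡ pt' y i) →
                        Connected pt → Connected pt'
  Connected-transport f f-pt g g-pt conn l l' len tot =
    ∼-sym (return l) ⨾ ∼-map f (λ _ → id) f-pt (λ _ _ _ → refl) (conn _ _ len' tot') ⨾ return l'
    where
    open ≡-Reasoning
    return : ∀ l → pt' ⊢ map f (map g l) ∼ l
    return []      = nil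
    return (y ∷ l) = cons (λ i → trans (f-pt (g y) i) (g-pt y i)) (return l)
    total-g : ∀ l i → total pt (map g l) i ≡ total pt' l i
    total-g []      i = refl
    total-g (y ∷ l) i = cong₂ ℤ._+_ (g-pt y i) (total-g l i)
    len' : length (map g l) ≡ length (map g l')
    len' = trans (length-map g l) (trans len (sym (length-map g l')))
    tot' : ∀ i → total pt (map g l) i ≡ total pt (map g l') i
    tot' i = trans (total-g l i) (trans (tot i) (sym (total-g l' i)))

-- Positive parts and signs of integers

posPart : ℤ → ℕ
posPart (+ k)    = k
posPart -[1+ k ] = 0

posPart≤∣∣ : ∀ z → posPart z ≤ ∣ z ∣
posPart≤∣∣ (+ k)    = ℕₚ.≤-refl
posPart≤∣∣ -[1+ k ] = z≤n

≤-posPart : ∀ z → z ℤ.≤ + posPart z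
≤-posPart (+ k)    = ℤₚ.≤-refl
≤-posPart -[1+ k ] = ℤ.-≤+

posPart-mono : ∀ {z w} → z ℤ.≤ w → posPart z ≤ posPart w
posPart-mono (ℤ.-≤- _) = z≤n
posPart-mono ℤ.-≤+     = z≤n
posPart-mono (ℤ.+≤+ p) = p

posPart-+ : ∀ z w → posPart (z ℤ.+ w) ≤ posPart z ℕ.+ posPart w
posPart-+ z w = posPart-mono (ℤₚ.+-mono-≤ (≤-posPart z) (≤-posPart w))

infix 4 _⊴_ _∥_

-- z ⊴ w and z ∥ w compare signs only: z never has a sign that w lacks, and
-- z and w never have opposite signs.
_⊴_ _∥_ : ℤ → ℤ → Set
z ⊴ w = (0ℤ ℤ.< z → 0ℤ ℤ.< w) × (z ℤ.< 0ℤ → w ℤ.< 0ℤ)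
z ∥ w = (0ℤ ℤ.< z → 0ℤ ℤ.≤ w) × (z ℤ.< 0ℤ → w ℤ.≤ 0ℤ)

⊴-refl : ∀ {z} → z ⊴ z
⊴-refl = id , id

⊴-trans : ∀ {x y z} → x ⊴ y → y ⊴ z → x ⊴ z
⊴-trans (p , q) (p' , q') = p' ∘ p , q' ∘ q

0⊴ : ∀ {z} → 0ℤ ⊴ z
0⊴ = (λ { (ℤ.+<+ ()) }) , λ { (ℤ.+<+ ()) }

0∥ : ∀ {z} → 0ℤ ∥ z
0∥ = (λ { (ℤ.+<+ ()) }) , λ { (ℤ.+<+ ()) }

∥0 : ∀ {z} → z ∥ 0ℤ
∥0 = (λ _ → ℤₚ.≤-refl) , λ _ → ℤₚ.≤-refl

∥⇒⊴ˡ : ∀ {z w} → z ∥ w → z ⊴ z ℤ.+ w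
∥⇒⊴ˡ (p , q) = (λ z>0 → ℤₚ.+-mono-<-≤ z>0 (p z>0)) , λ z<0 → ℤₚ.+-mono-<-≤ z<0 (q z<0)

∥-sym : ∀ {z w} → z ∥ w → w ∥ z
∥-sym (p , q) = (λ w>0 → ℤₚ.≮⇒≥ (λ z<0 → ℤₚ.<⇒≱ w>0 (q z<0))) ,
                λ w<0 → ℤₚ.≮⇒≥ (λ z>0 → ℤₚ.<⇒≱ w<0 (p z>0))

∥⇒⊴ʳ : ∀ {z w} → z ∥ w → w ⊴ z ℤ.+ w
∥⇒⊴ʳ {z} {w} c = subst (w ⊴_) (ℤₚ.+-comm w z) (∥⇒⊴ˡ (∥-sym c))

-- The induction step of `sweep`: a head passing later from z' to z gains no new sign, so it stays
-- compatible with the w met earlier.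
⊴-∥-+ : ∀ {z z' w t} → z ⊴ z' → z' ∥ w → z ∥ t → z ∥ (w ℤ.+ t)
⊴-∥-+ (p , q) (p' , q') (p″ , q″) =
  (λ z>0 → ℤₚ.+-mono-≤ (p' (p z>0)) (p″ z>0)) , λ z<0 → ℤₚ.+-mono-≤ (q' (q z<0)) (q″ z<0)

-- The bounds on absolute values keep both new points in a down-closed set; `left⊴` lets
-- compatibility with earlier points survive later cancellations.
record Cancelled (z w : ℤ) : Set where
  constructor cancelled
  field
    left right : ℤ
    sum≡   : left ℤ.+ right ≡ z ℤ.+ w
    ∣left∣≤  : ∣ left ∣ ≤ ∣ z ∣
    ∣right∣≤ : ∣ right ∣ ≤ ∣ w ∣
    left⊴  : left ⊴ z
    left∥  : left ∥ right

⊖-⊴ : ∀ {m n} → n ≤ m → m ⊖ n ⊴ + m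
⊖-⊴ {m} {n} n≤m =
  (λ p → ℤₚ.<-≤-trans p (ℤₚ.m⊖n≤m m n)) ,
  λ q → contradiction (subst (0ℤ ℤ.≤_) (sym (ℤₚ.⊖-≥ n≤m)) (ℤ.+≤+ z≤n)) (ℤₚ.<⇒≱ q)

⊖-⊵ : ∀ {m n} → m ≤ suc n → m ⊖ suc n ⊴ -[1+ n ]
⊖-⊵ {m} {n} m≤n =
  (λ p → contradiction
    (subst (ℤ._≤ 0ℤ) (sym (ℤₚ.⊖-≤ m≤n)) (ℤₚ.neg-mono-≤ (ℤ.+≤+ (z≤n {suc n ∸ m})))) (ℤₚ.<⇒≱ p)) ,
  λ _ → ℤ.-<+

∣⊖∣≤ˡ : ∀ {m n} → n ≤ m → ∣ m ⊖ n ∣ ≤ m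
∣⊖∣≤ˡ {m} {n} n≤m = subst (_≤ m) (cong ∣_∣ (sym (ℤₚ.⊖-≥ n≤m))) (ℕₚ.m∸n≤m m n)

∣⊖∣≤ʳ : ∀ {m n} → m ≤ n → ∣ m ⊖ n ∣ ≤ n
∣⊖∣≤ʳ {m} {n} m≤n = subst (_≤ n) (sym (ℤₚ.∣⊖∣-≤ m≤n)) (ℕₚ.m∸n≤m n m)

-- Entries of opposite sign merge: their whole sum goes to the one of larger absolute value and the
-- other becomes 0. Otherwise nothing changes.
cancel : ∀ z w → Cancelled z w
cancel (+ a) (+ b) = cancelled (+ a) (+ b) refl ℕₚ.≤-refl ℕₚ.≤-refl ⊴-refl
  ((λ _ → ℤ.+≤+ z≤n) , λ { (ℤ.+<+ ()) })
cancel -[1+ a ] -[1+ b ] = cancelled -[1+ a ] -[1+ b ] refl ℕₚ.≤-refl ℕₚ.≤-refl ⊴-refl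
  ((λ ()) , λ _ → ℤ.-≤+)
cancel (+ a) -[1+ b ] with ℕₚ.≤-total a (suc b)
... | inj₁ a≤b = cancelled 0ℤ (a ⊖ suc b) (ℤₚ.+-identityˡ _) z≤n (∣⊖∣≤ʳ a≤b) 0⊴ 0∥
... | inj₂ b≤a = cancelled (a ⊖ suc b) 0ℤ (ℤₚ.+-identityʳ _) (∣⊖∣≤ˡ b≤a) z≤n (⊖-⊴ b≤a) ∥0
cancel -[1+ a ] (+ b) with ℕₚ.≤-total b (suc a)
... | inj₁ b≤a = cancelled (b ⊖ suc a) 0ℤ (ℤₚ.+-identityʳ _) (∣⊖∣≤ʳ b≤a) z≤n (⊖-⊵ b≤a) ∥0
... | inj₂ a≤b = cancelled 0ℤ (b ⊖ suc a) (ℤₚ.+-identityˡ _) z≤n (∣⊖∣≤ˡ a≤b) 0⊴ 0∥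

-- A nonzero z has the sign of b. For b = 0 the conventional sign + does no harm, since z ⊴ 0 forces
-- z = 0.
⊴-sign◃1*∣∣ : ∀ {z} b → z ⊴ b → (sign b ◃ 1) ℤ.* + ∣ z ∣ ≡ z
⊴-sign◃1*∣∣ {+ zero}  b c       = ℤₚ.*-zeroʳ (sign b ◃ 1)
⊴-sign◃1*∣∣ {+ suc k} b (p , _) with b | p (ℤ.+<+ (s≤s z≤n))
... | + _     | _  = ℤₚ.*-identityˡ (+ suc k)
... | -[1+ _ ] | ()
⊴-sign◃1*∣∣ { -[1+ k ]} b (_ , q) with b | q ℤ.-<+
... | + _      | ℤ.+<+ ()
... | -[1+ _ ] | _ = ℤₚ.-1*i≡-i (+ suc k)

∣sign◃1*∣ : ∀ b z → ∣ (sign b ◃ 1) ℤ.* z ∣ ≡ ∣ z ∣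
∣sign◃1*∣ b z = trans (ℤₚ.abs-* (sign b ◃ 1) z)
  (trans (cong (ℕ._* ∣ z ∣) (ℤₚ.abs-◃ (sign b) 1)) (ℕₚ.*-identityˡ ∣ z ∣))

-- Down-closed sets: cutting to a prescribed sum

module DownClosed {n} (T : (Fin n → ℕ) → Set)
                  (down : ∀ {f g} → T f → (∀ i → g i ≤ f i) → T g) where

  -- Models of the lattice points of P and of P^±: one down-closed predicate on absolute values
  -- describes both.
  Pos Signed : Set
  Pos    = Σ (Fin n → ℕ) T
  Signed = Σ (Fin n → ℤ) (λ f → T (λ i → ∣ f i ∣))

  ptᴾ : Pos → Fin n → ℤ
  ptᴾ x i = + proj₁ x i

  ptˢ : Signed → Fin n → ℤ
  ptˢ = proj₁

  totalℕ : List Pos → Fin n → ℕ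
  totalℕ l i = foldr (λ x s → proj₁ x i ℕ.+ s) 0 l

  total≡ : ∀ l i → total ptᴾ l i ≡ + totalℕ l i
  total≡ []      i = refl
  total≡ (x ∷ l) i = cong (ℤ._+_ (+ proj₁ x i)) (total≡ l i)

  totalℕ-cong : ∀ {l l'} → ptᴾ ⊢ l ∼ l' → ∀ i → totalℕ l i ≡ totalℕ l' i
  totalℕ-cong {l} {l'} p i =
    ℤₚ.+-injective (trans (sym (total≡ l i)) (trans (∼-total p i) (total≡ l' i)))

  _≼_ : Pos → Pos → Set
  x ≼ y = ∀ i → proj₁ x i ≤ proj₁ y i

  infixl 7 _⊓ᴾ_
  _⊓ᴾ_ : Pos → (Fin n → ℕ) → Pos
  x ⊓ᴾ b = (λ i → proj₁ x i ⊓ b i) , down (proj₂ x) (λ i → ℕₚ.m⊓n≤m _ (b i))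

  -- Greedy cutting: each c takes as much of b as it can hold and passes on the rest. By `∼fill`
  -- this is a normal form for the lists with sum b lying entrywise below the capacities.
  fill : List Pos → (Fin n → ℕ) → List Pos
  fill []       b = []
  fill (c ∷ cs) b = c ⊓ᴾ b ∷ fill cs (λ i → b i ∸ proj₁ c i)

  fill-cong : ∀ cs {b b'} → (∀ i → b i ≡ b' i) → ptᴾ ⊢ fill cs b ∼ fill cs b'
  fill-cong []       e = nil
  fill-cong (c ∷ cs) e =
    cons (λ i → cong (λ t → + (proj₁ c i ⊓ t)) (e i)) (fill-cong cs (λ i → cong (_∸ proj₁ c i) (e i)))

  fill≼ : ∀ cs b → Pointwise _≼_ (fill cs b) cs
  fill≼ []       b = []
  fill≼ (c ∷ cs) b = (λ i → ℕₚ.m⊓n≤m _ _) ∷ fill≼ cs _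

  total-fill : ∀ cs b i → b i ≤ totalℕ cs i → totalℕ (fill cs b) i ≡ b i
  total-fill []       b i b≤ = sym (ℕₚ.n≤0⇒n≡0 b≤)
  total-fill (c ∷ cs) b i b≤ = begin
    (proj₁ c i ⊓ b i) ℕ.+ totalℕ (fill cs _) i ≡⟨ cong (_ ℕ.+_) (total-fill cs _ i (ℕₚ.m≤n+o⇒m∸n≤o _ _ b≤)) ⟩
    (proj₁ c i ⊓ b i) ℕ.+ (b i ∸ proj₁ c i)    ≡⟨ ℕₚ.m⊓n+n∸m≡n (proj₁ c i) (b i) ⟩
    b i                                        ∎
    where open ≡-Reasoning

  -- The head absorbs mass from the points of l one after another, up to the capacity c. Each donor
  -- y only decreases, because x ≼ c gives x + y ∸ c ≤ y; hence it stays in `T` and below its own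
  -- capacity.
  pour : ∀ c x l → x ≼ c → ∃₂ λ y l' →
         (ptᴾ ⊢ x ∷ l ∼ y ∷ l') × Pointwise _≼_ l' l ×
         (∀ i → proj₁ y i ≡ proj₁ c i ⊓ (proj₁ x i ℕ.+ totalℕ l i))
  pour c x [] x≤c = x , [] , ∼-refl _ , [] , λ i →
    sym (trans (cong (proj₁ c i ⊓_) (ℕₚ.+-identityʳ _)) (ℕₚ.m≥n⇒m⊓n≡n (x≤c i)))
  pour c x (y ∷ l) x≤c =
    let z , l' , p , l'≤l , z≡ = pour c x' l (λ i → ℕₚ.m⊓n≤m _ _)
    in z , y' ∷ l' ,
       -- The depleted y' is swapped out of the way while the head continues along l.
       move l xy ⨾ ∼-swap x' y' l ⨾ cons (λ _ → refl) p ⨾ ∼-swap y' z l' ,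
       y'≤y ∷ l'≤l ,
       λ i → trans (z≡ i) (min-+ (proj₁ c i) (proj₁ x i) (proj₁ y i) (totalℕ l i))
    where
    x' y' : Pos
    x' = c ⊓ᴾ (λ i → proj₁ x i ℕ.+ proj₁ y i)
    y'≤ : ∀ i → proj₁ x i ℕ.+ proj₁ y i ∸ proj₁ c i ≤ proj₁ y i
    y'≤ i = ℕₚ.m≤n+o⇒m∸n≤o _ (proj₁ c i) (ℕₚ.+-monoˡ-≤ (proj₁ y i) (x≤c i))
    y' = (λ i → proj₁ x i ℕ.+ proj₁ y i ∸ proj₁ c i) , down (proj₂ y) y'≤
    y'≤y : y' ≼ y
    y'≤y = y'≤
    xy : ∀ i → ptᴾ x i ℤ.+ ptᴾ y i ≡ ptᴾ x' i ℤ.+ ptᴾ y' i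
    xy i = cong +_ (sym (ℕₚ.m⊓n+n∸m≡n (proj₁ c i) (proj₁ x i ℕ.+ proj₁ y i)))
    min-+ : ∀ c x y t → c ⊓ ((c ⊓ (x ℕ.+ y)) ℕ.+ t) ≡ c ⊓ (x ℕ.+ (y ℕ.+ t))
    min-+ c x y t = begin
      c ⊓ ((c ⊓ (x ℕ.+ y)) ℕ.+ t)         ≡⟨ cong (c ⊓_) (ℕₚ.+-distribʳ-⊓ t c (x ℕ.+ y)) ⟩
      c ⊓ ((c ℕ.+ t) ⊓ (x ℕ.+ y ℕ.+ t))   ≡⟨ ℕₚ.⊓-assoc c (c ℕ.+ t) _ ⟨
      (c ⊓ (c ℕ.+ t)) ⊓ (x ℕ.+ y ℕ.+ t)   ≡⟨ cong (_⊓ (x ℕ.+ y ℕ.+ t)) (ℕₚ.m≤n⇒m⊓n≡m (ℕₚ.m≤m+n c t)) ⟩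
      c ⊓ (x ℕ.+ y ℕ.+ t)                 ≡⟨ cong (c ⊓_) (ℕₚ.+-assoc x y t) ⟩
      c ⊓ (x ℕ.+ (y ℕ.+ t))               ∎
      where open ≡-Reasoning

  -- Once `pour` has made the head maximal it agrees with the head of `fill`, and cancelling it from
  -- the total leaves the same problem for the tail.
  ∼fill : ∀ {l cs} b → Pointwise _≼_ l cs → (∀ i → b i ≡ totalℕ l i) → ptᴾ ⊢ l ∼ fill cs b
  ∼fill b [] b≡ = nil
  ∼fill {x ∷ l} {c ∷ cs} b (x≤c ∷ l≤cs) b≡ =
    let y , l' , p , l'≤l , y≡ = pour c x l x≤c
        y≡∧ : ∀ i → proj₁ y i ≡ proj₁ c i ⊓ b i
        y≡∧ i = trans (y≡ i) (cong (proj₁ c i ⊓_) (sym (b≡ i)))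
    in p ⨾ cons (λ i → cong +_ (y≡∧ i))
             (∼fill _ (Pointwise.transitive (λ r s i → ℕₚ.≤-trans (r i) (s i)) l'≤l l≤cs) λ i →
               ℕₚ.+-cancelˡ-≡ (proj₁ c i ⊓ b i) _ _ (begin
                 (proj₁ c i ⊓ b i) ℕ.+ (b i ∸ proj₁ c i) ≡⟨ ℕₚ.m⊓n+n∸m≡n (proj₁ c i) (b i) ⟩
                 b i                                     ≡⟨ b≡ i ⟩
                 totalℕ (x ∷ l) i                        ≡⟨ totalℕ-cong p i ⟩
                 totalℕ (y ∷ l') i                       ≡⟨ cong (ℕ._+ totalℕ l' i) (y≡∧ i) ⟩
                 (proj₁ c i ⊓ b i) ℕ.+ totalℕ l' i       ∎))
    where open ≡-Reasoning

  -- From signed moves to nonnegative moves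

  positive : Signed → Pos
  positive (f , t) = (λ i → posPart (f i)) , down t (λ i → posPart≤∣∣ (f i))

  posPart-total : ∀ l i → posPart (total ptˢ l i) ≤ totalℕ (map positive l) i
  posPart-total []      i = z≤n
  posPart-total (x ∷ l) i =
    ℕₚ.≤-trans (posPart-+ (ptˢ x i) _) (ℕₚ.+-monoʳ-≤ _ (posPart-total l i))

  -- For a move x, y ↦ u, v the sums x⁺ + y⁺ and u⁺ + v⁺ may differ, but both
  -- dominate (x + y)⁺, so both pairs can be cut to the same sum.
  ∼-fill-positive : ∀ {l l'} → ptˢ ⊢ l ∼ l' → ∀ b → (∀ i → b i ≤ posPart (total ptˢ l i)) →
                    ptᴾ ⊢ fill (map positive l) b ∼ fill (map positive l') b
  ∼-fill-positive nil b b≤ = nil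
  ∼-fill-positive {x ∷ l} {y ∷ l'} (cons e p) b b≤ =
    cons (λ i → cong (λ t → + (posPart t ⊓ b i)) (e i))
      (∼-fill-positive p _ (λ i →
         ℕₚ.m≤n+o⇒m∸n≤o _ _ (ℕₚ.≤-trans (b≤ i) (posPart-+ (ptˢ x i) _)))
       ⨾ fill-cong (map positive l') (λ i → cong (λ t → b i ∸ posPart t) (e i)))
  ∼-fill-positive (p ⨾ q) b b≤ =
    ∼-fill-positive p b b≤ ⨾
    ∼-fill-positive q b (λ i → subst (λ t → b i ≤ posPart t) (∼-total p i) (b≤ i))
  ∼-fill-positive {x ∷ y ∷ _} {u ∷ v ∷ _} (move l e) b b≤ =
    ∼-sym (split x y (λ _ → refl)) ⨾
    move rest (λ i → cong +_ (trans (pair x y (λ _ → refl) i) (sym (pair u v e i)))) ⨾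
    split u v e
    where
    open ≡-Reasoning
    s : Fin n → ℤ
    s i = ptˢ x i ℤ.+ ptˢ y i
    -- The shares of b for the moved pair and for the remaining points. Apart from b they depend
    -- only on x + y = u + v, so `rest` is common to both sides and a single move between the pairs
    -- connects them.
    b₁ b₂ : Fin n → ℕ
    b₁ i = posPart (s i) ⊓ b i
    b₂ i = b i ∸ posPart (s i)
    rest : List Pos
    rest = fill (map positive l) b₂
    total-rest : ∀ i → totalℕ rest i ≡ b₂ i
    -- With t the total of l, b ≤ (s + t)⁺ ≤ s⁺ + t⁺, so `b₂` fits under the positive parts of l.
    total-rest i = total-fill (map positive l) b₂ i (ℕₚ.≤-trans
      (ℕₚ.m≤n+o⇒m∸n≤o _ (posPart (s i)) (ℕₚ.≤-trans
        (subst (λ t → b i ≤ posPart t) (sym (ℤₚ.+-assoc (ptˢ x i) (ptˢ y i) _)) (b≤ i))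
        (posPart-+ (s i) _)))
      (posPart-total l i))
    first second : Signed → Signed → Pos
    first  z w = positive z ⊓ᴾ b₁
    second z w = positive w ⊓ᴾ (λ i → b₁ i ∸ posPart (ptˢ z i))
    pair : ∀ z w → (∀ i → s i ≡ ptˢ z i ℤ.+ ptˢ w i) → ∀ i →
           proj₁ (first z w) i ℕ.+ proj₁ (second z w) i ≡ b₁ i
    pair z w e i = begin
      proj₁ (first z w) i ℕ.+ proj₁ (second z w) i         ≡⟨ cong (proj₁ (first z w) i ℕ.+_) (ℕₚ.+-identityʳ _) ⟨
      totalℕ (fill (positive z ∷ positive w ∷ []) b₁) i    ≡⟨ total-fill (positive z ∷ positive w ∷ []) b₁ i b₁≤ ⟩
      b₁ i                                                 ∎
      where
      b₁≤ : b₁ i ≤ totalℕ (positive z ∷ positive w ∷ []) i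
      b₁≤ = ℕₚ.≤-trans (ℕₚ.m⊓n≤m _ _) (subst (λ t → posPart t ≤ totalℕ (positive z ∷ positive w ∷ []) i)
              (sym (trans (e i) (cong (ℤ._+_ (ptˢ z i)) (sym (ℤₚ.+-identityʳ _)))))
              (posPart-total (z ∷ w ∷ []) i))
    split : ∀ z w → (∀ i → s i ≡ ptˢ z i ℤ.+ ptˢ w i) →
            ptᴾ ⊢ first z w ∷ second z w ∷ rest ∼ fill (map positive (z ∷ w ∷ l)) b
    split z w e = ∼fill b
      ((λ i → ℕₚ.m⊓n≤m _ _) ∷ (λ i → ℕₚ.m⊓n≤m _ _) ∷ fill≼ (map positive l) b₂)
      λ i → begin
        b i                         ≡⟨ ℕₚ.m⊓n+n∸m≡n (posPart (s i)) (b i) ⟨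
        b₁ i ℕ.+ b₂ i               ≡⟨ cong₂ ℕ._+_ (sym (pair z w e i)) (sym (total-rest i)) ⟩
        proj₁ (first z w) i ℕ.+ proj₁ (second z w) i ℕ.+ totalℕ rest i
          ≡⟨ ℕₚ.+-assoc (proj₁ (first z w) i) _ _ ⟩
        totalℕ (first z w ∷ second z w ∷ rest) i ∎

  include : Pos → Signed
  include (f , t) = (λ i → + f i) , t

  Connectedˢ⇒Connectedᴾ : Connected ptˢ → Connected ptᴾ
  Connectedˢ⇒Connectedᴾ conn l l' len tot =
    -- At both ends of the chain the capacities are the original points, so l and l' are themselves
    -- admissible cuts with sum b.
    ∼fill b (diagonal l) (λ _ → refl) ⨾
    ∼-fill-positive p b (λ i → ℕₚ.≤-reflexive (cong posPart (sym (trans (total-include l i) (total≡ l i))))) ⨾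
    ∼-sym (∼fill b (diagonal l') λ i →
      ℤₚ.+-injective (trans (sym (total≡ l i)) (trans (tot i) (total≡ l' i))))
    where
    b : Fin n → ℕ
    b = totalℕ l
    diagonal : ∀ l → Pointwise _≼_ l (map positive (map include l))
    diagonal []      = []
    diagonal (x ∷ l) = (λ i → ℕₚ.≤-refl) ∷ diagonal l
    total-include : ∀ l i → total ptˢ (map include l) i ≡ total ptᴾ l i
    total-include []      i = refl
    total-include (x ∷ l) i = cong (ℤ._+_ (+ proj₁ x i)) (total-include l i)
    p : ptˢ ⊢ map include l ∼ map include l'
    p = conn _ _
      (trans (length-map include l) (trans len (sym (length-map include l'))))
      (λ i → trans (total-include l i) (trans (tot i) (sym (total-include l' i))))

  -- Bringing signed multisets into one orthant

  sweep : ∀ z l → ∃₂ λ z' l' → (ptˢ ⊢ z ∷ l ∼ z' ∷ l') × length l' ≡ length l ×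
          (∀ i → ptˢ z' i ⊴ ptˢ z i) × (∀ i → ptˢ z' i ∥ total ptˢ l' i)
  sweep z []      = z , [] , ∼-refl _ , refl , (λ i → ⊴-refl) , λ i → ∥0
  sweep z (w ∷ l) =
    -- What `cancel` leaves of z goes on through l; gaining no sign on the way, it stays compatible
    -- with `w₁`.
    let z' , l' , p , len , z'⊴ , z'∥ = sweep z₁ l
    in z' , w₁ ∷ l' ,
       move l (λ i → sym (sum≡ (c i))) ⨾ ∼-swap z₁ w₁ l ⨾ cons (λ _ → refl) p ⨾ ∼-swap w₁ z' l' ,
       cong suc len ,
       (λ i → ⊴-trans (z'⊴ i) (left⊴ (c i))) ,
       λ i → ⊴-∥-+ (z'⊴ i) (left∥ (c i)) (z'∥ i)
    where
    open Cancelled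
    c : ∀ i → Cancelled (ptˢ z i) (ptˢ w i)
    c i = cancel (ptˢ z i) (ptˢ w i)
    z₁ w₁ : Signed
    z₁ = (λ i → left  (c i)) , down (proj₂ z) (λ i → ∣left∣≤  (c i))
    w₁ = (λ i → right (c i)) , down (proj₂ w) (λ i → ∣right∣≤ (c i))

  -- Geometrically, all points lie in one closed orthant given by b and vanish in the coordinates
  -- where b does.
  Coherent : List Signed → (Fin n → ℤ) → Set
  Coherent l b = All (λ x → ∀ i → ptˢ x i ⊴ b i) l

  Coherent-mono : ∀ {l b b'} → (∀ i → b i ⊴ b' i) → Coherent l b → Coherent l b'
  Coherent-mono b⊴b' = All.map (λ c i → ⊴-trans (c i) (b⊴b' i))

  -- If z' is compatible with the total t of the other points, then both z' and t are ⊴ z' + t, so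
  -- coherence of the tail with its own total passes on to the full total. The recursion is on the
  -- length, as `sweep` rewrites the tail.
  cohere : ∀ k l → length l ≡ k → ∃ λ l' → (ptˢ ⊢ l ∼ l') × Coherent l' (total ptˢ l)
  cohere zero    []      _   = [] , nil , []
  cohere (suc k) (z ∷ l) len =
    let z' , l' , p , len' , _ , z'∥ = sweep z l
        l″ , q , coh = cohere k l' (trans len' (ℕₚ.suc-injective len))
    in z' ∷ l″ , p ⨾ cons (λ _ → refl) q ,
       subst-total p (λ i → ∥⇒⊴ˡ (z'∥ i)) ∷
       Coherent-mono (subst-total p (λ i → ∥⇒⊴ʳ (z'∥ i))) coh
    where
    subst-total : ∀ {l l'} {f : Fin n → ℤ} → ptˢ ⊢ l ∼ l' →
                  (∀ i → f i ⊴ total ptˢ l' i) → ∀ i → f i ⊴ total ptˢ l i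
    subst-total {f = f} p c i = subst (f i ⊴_) (sym (∼-total p i)) (c i)

  absolute : Signed → Pos
  absolute (f , t) = (λ i → ∣ f i ∣) , t

  module Reflection (b : Fin n → ℤ) where

    reflect : Pos → Signed
    reflect (f , t) = (λ i → (sign (b i) ◃ 1) ℤ.* + f i) ,
                      -- The bound is an equality: `down` carries `T` along it coordinatewise, in
                      -- place of function extensionality.
                      down t (λ i → ℕₚ.≤-reflexive (∣sign◃1*∣ (b i) (+ f i)))

    reflect-∼ : ∀ {l l'} → ptᴾ ⊢ l ∼ l' → ptˢ ⊢ map reflect l ∼ map reflect l'
    reflect-∼ = ∼-map reflect (λ i a → (sign (b i) ◃ 1) ℤ.* a) (λ _ _ → refl)
                      (λ i → ℤₚ.*-distribˡ-+ (sign (b i) ◃ 1))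

    reflect-absolute : ∀ {l} → Coherent l b → ptˢ ⊢ map reflect (map absolute l) ∼ l
    reflect-absolute []       = nil
    reflect-absolute (c ∷ cs) = cons (λ i → ⊴-sign◃1*∣∣ (b i) (c i)) (reflect-absolute cs)

    total-absolute : ∀ {l} → Coherent l b → ∀ i →
                     (sign (b i) ◃ 1) ℤ.* total ptᴾ (map absolute l) i ≡ total ptˢ l i
    total-absolute []       i = ℤₚ.*-zeroʳ (sign (b i) ◃ 1)
    total-absolute (c ∷ cs) i = trans (ℤₚ.*-distribˡ-+ (sign (b i) ◃ 1) _ _)
      (cong₂ ℤ._+_ (⊴-sign◃1*∣∣ (b i) (c i)) (total-absolute cs i))

    -- Nothing cancels within an orthant: reflecting this total gives the signed one, and reflecting
    -- preserves absolute values. Hence equal signed totals yield equal totals in P.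
    ∣total∣ : ∀ {l} → Coherent l b → ∀ i → total ptᴾ (map absolute l) i ≡ + ∣ total ptˢ l i ∣
    ∣total∣ {l} coh i = begin
      total ptᴾ (map absolute l) i          ≡⟨ total≡ (map absolute l) i ⟩
      + totalℕ (map absolute l) i           ≡⟨ cong (+_ ∘ ∣_∣) (total≡ (map absolute l) i) ⟨
      + ∣ total ptᴾ (map absolute l) i ∣    ≡⟨ cong +_ (∣sign◃1*∣ (b i) _) ⟨
      + ∣ (sign (b i) ◃ 1) ℤ.* total ptᴾ (map absolute l) i ∣ ≡⟨ cong (+_ ∘ ∣_∣) (total-absolute coh i) ⟩
      + ∣ total ptˢ l i ∣                   ∎
      where open ≡-Reasoning

  Connectedᴾ⇒Connectedˢ : Connected ptᴾ → Connected ptˢ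
  Connectedᴾ⇒Connectedˢ conn l₁ l₂ len tot =
    let l₁' , p₁ , c₁ = cohere _ l₁ refl
        l₂' , p₂ , c  = cohere _ l₂ refl
        -- One reflection must serve both sides, so the second multiset is made coherent with the
        -- total of the first.
        c₂   = Coherent-mono (λ i → subst (total ptˢ l₂ i ⊴_) (sym (tot i)) ⊴-refl) c
        len' = trans (length-map absolute l₁') (trans (sym (∼-length p₁)) (trans len
                 (trans (∼-length p₂) (sym (length-map absolute l₂')))))
        tot' i = trans (∣total∣ c₁ i) (trans
                   (cong (+_ ∘ ∣_∣) (trans (sym (∼-total p₁ i)) (trans (tot i) (∼-total p₂ i))))
                   (sym (∣total∣ c₂ i)))
    in p₁ ⨾ ∼-sym (reflect-absolute c₁) ⨾ reflect-∼ (conn _ _ len' tot') ⨾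
       reflect-absolute c₂ ⨾ ∼-sym p₂
    where open Reflection (total ptˢ l₁)

-- Exponent vectors and lists of variables

infixl 6 _⊕_
_⊕_ : Vec ℕ m → Vec ℕ m → Vec ℕ m
_⊕_ = zipWith ℕ._+_

𝟘 : Vec ℕ m
𝟘 = replicate _ 0

⊕-assoc : (α β γ : Vec ℕ m) → α ⊕ β ⊕ γ ≡ α ⊕ (β ⊕ γ)
⊕-assoc = Vecₚ.zipWith-assoc ℕₚ.+-assoc

⊕-comm : (α β : Vec ℕ m) → α ⊕ β ≡ β ⊕ α
⊕-comm = Vecₚ.zipWith-comm ℕₚ.+-comm

⊕-identityˡ : (α : Vec ℕ m) → 𝟘 ⊕ α ≡ α
⊕-identityˡ = Vecₚ.zipWith-identityˡ ℕₚ.+-identityˡ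

⊕-identityʳ : (α : Vec ℕ m) → α ⊕ 𝟘 ≡ α
⊕-identityʳ = Vecₚ.zipWith-identityʳ ℕₚ.+-identityʳ

unit : Fin m → Vec ℕ m
unit Fin.zero    = 1 ∷ 𝟘
unit (Fin.suc i) = 0 ∷ unit i

monomial : List (Fin m) → Vec ℕ m
monomial = foldr (λ i α → unit i ⊕ α) 𝟘

-- Spells out a monomial in the form on which moves act. `monomial` undoes it exactly; it undoes
-- `monomial` up to permutation.
indices : Vec ℕ m → List (Fin m)
indices []      = []
indices (k ∷ α) = List.replicate k Fin.zero ++ map Fin.suc (indices α)

monomial-indices : (α : Vec ℕ m) → monomial (indices α) ≡ α
monomial-indices []      = refl
monomial-indices (k ∷ α) = trans (zeros k (map Fin.suc (indices α)))
  (trans (cong ((k ∷ 𝟘) ⊕_) (trans (sucs (indices α)) (cong (0 ∷_) (monomial-indices α))))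
         (cong₂ _∷_ (ℕₚ.+-identityʳ k) (⊕-identityˡ α)))
  where
  sucs : (l : List (Fin m)) → monomial (map Fin.suc l) ≡ 0 ∷ monomial l
  sucs []      = refl
  sucs (i ∷ l) = cong ((0 ∷ unit i) ⊕_) (sucs l)
  zeros : ∀ k (l : List (Fin (suc m))) → monomial (List.replicate k Fin.zero ++ l) ≡ (k ∷ 𝟘) ⊕ monomial l
  zeros zero    l = sym (⊕-identityˡ (monomial l))
  zeros (suc k) l = trans (cong (unit Fin.zero ⊕_) (zeros k l))
    (trans (sym (⊕-assoc (unit Fin.zero) (k ∷ 𝟘) (monomial l)))
           (cong (λ α → (suc k ∷ α) ⊕ monomial l) (⊕-identityˡ 𝟘)))

indices-unit : ∀ i (α : Vec ℕ m) → indices (unit i ⊕ α) ↭ i ∷ indices α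
indices-unit Fin.zero    (k ∷ α) =
  ↭-reflexive (cong (λ β → Fin.zero ∷ List.replicate k Fin.zero ++ map Fin.suc (indices β)) (⊕-identityˡ α))
indices-unit (Fin.suc i) (k ∷ α) = ↭-trans
  (Permₚ.++⁺ˡ (List.replicate k Fin.zero) (Permₚ.map⁺ Fin.suc (indices-unit i α)))
  (Permₚ.shift (Fin.suc i) (List.replicate k Fin.zero) _)

indices-𝟘 : indices (𝟘 {m}) ≡ []
indices-𝟘 {zero}  = refl
indices-𝟘 {suc m} = cong (map Fin.suc) (indices-𝟘 {m})

indices-monomial-⊕ : ∀ l (α : Vec ℕ m) → indices (monomial l ⊕ α) ↭ l ++ indices α
indices-monomial-⊕ []      α = ↭-reflexive (cong indices (⊕-identityˡ α))
indices-monomial-⊕ (i ∷ l) α = ↭-trans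
  (↭-reflexive (cong indices (⊕-assoc (unit i) (monomial l) α)))
  (↭-trans (indices-unit i (monomial l ⊕ α)) (prep i (indices-monomial-⊕ l α)))

indices-monomial : ∀ (l : List (Fin m)) → indices (monomial l) ↭ l
indices-monomial l = ↭-trans
  (↭-reflexive (cong indices (sym (⊕-identityʳ (monomial l)))))
  (↭-trans (indices-monomial-⊕ l 𝟘)
           (↭-reflexive (trans (cong (l ++_) indices-𝟘) (++-identityʳ l))))

sum-⊕ : (α β : Vec ℕ m) → Vec.sum (α ⊕ β) ≡ Vec.sum α ℕ.+ Vec.sum β
sum-⊕ []      []      = refl
sum-⊕ (a ∷ α) (b ∷ β) = begin
  a ℕ.+ b ℕ.+ Vec.sum (α ⊕ β)              ≡⟨ cong (a ℕ.+ b ℕ.+_) (sum-⊕ α β) ⟩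
  a ℕ.+ b ℕ.+ (Vec.sum α ℕ.+ Vec.sum β)    ≡⟨ medial a b (Vec.sum α) (Vec.sum β) ⟩
  a ℕ.+ Vec.sum α ℕ.+ (b ℕ.+ Vec.sum β)    ∎
  where
  open ≡-Reasoning
  open CommutativeSemigroupProperties ℕₚ.+-commutativeSemigroup
    using () renaming (interchange to medial)

sum-𝟘 : ∀ m → Vec.sum (𝟘 {m}) ≡ 0
sum-𝟘 zero    = refl
sum-𝟘 (suc m) = sum-𝟘 m

sum-unit : (i : Fin m) → Vec.sum (unit i) ≡ 1
sum-unit {suc m} Fin.zero = cong suc (sum-𝟘 m)
sum-unit (Fin.suc i)      = sum-unit i

sum-monomial : (l : List (Fin m)) → Vec.sum (monomial l) ≡ length l
sum-monomial {m} []      = sum-𝟘 m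
sum-monomial     (i ∷ l) = trans (sum-⊕ (unit i) (monomial l)) (cong₂ ℕ._+_ (sum-unit i) (sum-monomial l))

lookup-ext : ∀ {a} {A : Set a} {u v : Vec A n} → (∀ i → lookup u i ≡ lookup v i) → u ≡ v
lookup-ext {u = u} {v} e =
  trans (sym (Vecₚ.tabulate∘lookup u)) (trans (Vecₚ.tabulate-cong e) (Vecₚ.tabulate∘lookup v))

↭⇒∼ : {X : Set} {pt : X → Fin n → ℤ} {l l' : List X} → l ↭ l' → pt ⊢ l ∼ l'
↭⇒∼ Perm.refl            = ∼-refl _
↭⇒∼ (Perm.prep x p)      = cons (λ _ → refl) (↭⇒∼ p)
↭⇒∼ (Perm.swap x y p)    = ∼-swap x y _ ⨾ cons (λ _ → refl) (cons (λ _ → refl) (↭⇒∼ p))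
↭⇒∼ (Perm.trans p q)     = ↭⇒∼ p ⨾ ↭⇒∼ q

ptⱽ : Vec (Vec ℤ n) m → Fin m → Fin n → ℤ
ptⱽ A j = lookup (lookup A j)

-- Classes generated by finitely many pairs

module UnionFind {X : Set} (_≟_ : (x y : X) → Dec (x ≡ y)) {R : X → X → Set} (R-refl : ∀ x → R x x)
  (R-sym : ∀ {x y} → R x y → R y x) (R-trans : ∀ {x y z} → R x y → R y z → R x z) where

  module Fuse (rep : X → X) (R-rep : ∀ x → R x (rep x)) {a b} (r : R a b) where

    fuse : X → X
    fuse x = if does (x ≟ rep a) then rep b else x

    fuse-a≡fuse-b : fuse (rep a) ≡ fuse (rep b)
    fuse-a≡fuse-b rewrite dec-true (rep a ≟ rep a) refl with does (rep b ≟ rep a)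
    ... | true  = refl
    ... | false = refl

    R-fuse : ∀ x → R x (fuse (rep x))
    R-fuse x with rep x ≟ rep a
    ... | yes e = R-trans (subst (R x) e (R-rep x)) (R-trans (R-sym (R-rep a)) (R-trans r (R-rep b)))
    ... | no  _ = R-rep x

  -- Each pair (a, b) redirects the class of `rep a` to `rep b`. Only equality in `X` is decided,
  -- never `R`, and the resulting classes refine those of `R`.
  representatives : (es : List (X × X)) → All (λ (x , y) → R x y) es →
    ∃ λ rep → (∀ x → R x (rep x)) × All (λ (x , y) → rep x ≡ rep y) es
  representatives []             []       = id , R-refl , []
  representatives ((a , b) ∷ es) (r ∷ rs) =
    let rep , R-rep , eqs = representatives es rs
        open Fuse rep R-rep r
    in fuse ∘ rep , R-fuse , fuse-a≡fuse-b ∷ All.map (cong fuse) eqs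

-- Polynomials seen through sums of coefficients

module _ {c ℓ : Level} (K : Field c ℓ) where

  open Field K using (Carrier; _≈_; _+_; _*_; -_; 0#; 1#; 1≉0; +-cong; *-cong;
    +-assoc; +-identityˡ; +-identityʳ; distribˡ; -‿inverseʳ; -‿inverseˡ; zeroʳ; *-identityʳ; -‿cong)
  private module F = Field K
  open RingProperties F.ring using (-‿+-comm; -‿distribʳ-*; -0#≈0#)
  open SetoidReasoning F.setoid
  open CommutativeSemigroupProperties F.+-commutativeSemigroup
    using (x∙yz≈y∙xz; interchange)

  -- Polynomials are unnormalised lists of terms, so they are handled through these additive
  -- functionals. `coeff` and `imageCoeff` are by definition the cases `coefficient` and `fibre`, so
  -- lemmas on `weight` apply to them directly.
  weight : (Vec ℕ m → Bool) → Poly K m → Carrier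
  weight φ p = foldr (λ t s → if φ (proj₂ t) then proj₁ t + s else s) 0# p

  coefficient : Vec ℕ m → Vec ℕ m → Bool
  coefficient α μ = does (Vecₚ.≡-dec ℕ._≟_ μ α)

  weight-++ : ∀ (φ : Vec ℕ m → Bool) (p q : Poly K m) → weight φ (p ++ q) ≈ weight φ p + weight φ q
  weight-++ φ []            q = F.sym (+-identityˡ _)
  weight-++ φ ((c , μ) ∷ p) q with φ μ
  ... | true  = F.trans (+-cong F.refl (weight-++ φ p q)) (F.sym (+-assoc c _ _))
  ... | false = weight-++ φ p q

  weight-cong : ∀ {φ ψ : Vec ℕ m → Bool} (p : Poly K m) →
    All (λ t → φ (proj₂ t) ≡ ψ (proj₂ t)) p → weight φ p ≡ weight ψ p
  weight-cong []            []       = refl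
  weight-cong ((c , μ) ∷ p) (e ∷ es) = cong₂ (λ b s → if b then c + s else s) e (weight-cong p es)

  weight-false : (p : Poly K m) → weight (λ _ → false) p ≡ 0#
  weight-false []      = refl
  weight-false (t ∷ p) = weight-false p

  weight-split : ∀ (φ χ : Vec ℕ m → Bool) (p : Poly K m) →
    weight φ p ≈ weight (λ μ → φ μ ∧ χ μ) p + weight (λ μ → φ μ ∧ not (χ μ)) p
  weight-split φ χ []            = F.sym (+-identityˡ 0#)
  weight-split φ χ ((c , μ) ∷ p) with φ μ | χ μ
  ... | false | _     = weight-split φ χ p
  ... | true  | true  = F.trans (+-cong F.refl (weight-split φ χ p)) (F.sym (+-assoc c _ _))
  ... | true  | false = F.trans (+-cong F.refl (weight-split φ χ p)) (x∙yz≈y∙xz c _ _)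

  weight-∧ : ∀ (φ : Vec ℕ m → Bool) α (p : Poly K m) →
    weight (λ μ → φ μ ∧ coefficient α μ) p ≡ (if φ α then coeff K p α else 0#)
  weight-∧ φ α p = trans (weight-cong p (All.tabulate λ {t} _ → agree (proj₂ t))) collapse
    where
    agree : ∀ μ → φ μ ∧ coefficient α μ ≡ φ α ∧ coefficient α μ
    agree μ with Vecₚ.≡-dec ℕ._≟_ μ α
    ... | yes refl = refl
    ... | no  _    with φ μ | φ α
    ... | true  | true  = refl
    ... | true  | false = refl
    ... | false | true  = refl
    ... | false | false = refl
    collapse : weight (λ μ → φ α ∧ coefficient α μ) p ≡ (if φ α then coeff K p α else 0#)
    collapse with φ α
    ... | true  = refl
    ... | false = weight-false p

  -- Terms with the same monomial may cancel anywhere in the list, so induction on p fails. Instead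
  -- `M` lists the monomials that φ may select in p, and each step splits off all terms with the
  -- monomial α at once.
  weight-null : (p : Poly K m) → (∀ α → coeff K p α ≈ 0#) → ∀ φ → weight φ p ≈ 0#
  weight-null {m} p null φ = go (map proj₂ p) φ (All.tabulate λ t∈p _ → ∈-map⁺ proj₂ t∈p)
    where
    go : ∀ M φ → All (λ t → φ (proj₂ t) ≡ true → proj₂ t ∈ M) p → weight φ p ≈ 0#
    go [] φ out = F.reflexive
      (trans (weight-cong p (All.map (λ {t} o → false! (proj₂ t) o) out)) (weight-false p))
      where
      false! : ∀ μ → (φ μ ≡ true → μ ∈ []) → φ μ ≡ false
      false! μ o with φ μ
      ... | false = refl
      ... | true  with () ← o refl
    go (α ∷ M) φ out = begin
      weight φ p ≈⟨ weight-split φ (coefficient α) p ⟩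
      weight (λ μ → φ μ ∧ coefficient α μ) p + weight (λ μ → φ μ ∧ not (coefficient α μ)) p
        ≈⟨ +-cong (F.trans (F.reflexive (weight-∧ φ α p)) at-α)
                  (go M _ (All.map (λ {t} → rest (proj₂ t)) out)) ⟩
      0# + 0#    ≈⟨ +-identityˡ 0# ⟩
      0#         ∎
      where
      at-α : (if φ α then coeff K p α else 0#) ≈ 0#
      at-α with φ α
      ... | true  = null α
      ... | false = F.refl
      rest : ∀ μ → (φ μ ≡ true → μ ∈ α ∷ M) → φ μ ∧ not (coefficient α μ) ≡ true → μ ∈ M
      rest μ o e with φ μ | Vecₚ.≡-dec ℕ._≟_ μ α
      ... | true | no μ≢α with o refl
      ...   | here μ≡α = contradiction μ≡α μ≢α
      ...   | there μ∈ = μ∈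

  negate : Poly K m → Poly K m
  negate = map (λ (c , μ) → - c , μ)

  weight-negate : ∀ (φ : Vec ℕ m → Bool) (p : Poly K m) → weight φ (negate p) ≈ - weight φ p
  weight-negate φ []            = F.sym -0#≈0#
  weight-negate φ ((c , μ) ∷ p) with φ μ
  ... | true  = F.trans (+-cong F.refl (weight-negate φ p)) (-‿+-comm c _)
  ... | false = weight-negate φ p

  weight-resp-≈ₚ : (p q : Poly K m) → _≈ₚ_ K p q → ∀ φ → weight φ p ≈ weight φ q
  weight-resp-≈ₚ p q p≈q φ = begin
    weight φ p                               ≈⟨ +-identityʳ _ ⟨
    weight φ p + 0#                          ≈⟨ +-cong F.refl (-‿inverseˡ _) ⟨
    weight φ p + (- weight φ q + weight φ q) ≈⟨ +-assoc _ _ _ ⟨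
    weight φ p + - weight φ q + weight φ q   ≈⟨ +-cong (difference φ) F.refl ⟨
    weight φ (p ++ negate q) + weight φ q    ≈⟨ +-cong (weight-null (p ++ negate q) null φ) F.refl ⟩
    0# + weight φ q                          ≈⟨ +-identityˡ _ ⟩
    weight φ q                               ∎
    where
    difference : ∀ φ → weight φ (p ++ negate q) ≈ weight φ p + - weight φ q
    difference φ = F.trans (weight-++ φ p (negate q)) (+-cong F.refl (weight-negate φ q))
    null : ∀ α → coeff K (p ++ negate q) α ≈ 0#
    null α = begin
      coeff K (p ++ negate q) α     ≈⟨ difference (coefficient α) ⟩
      coeff K p α + - coeff K q α   ≈⟨ +-cong (p≈q α) F.refl ⟩
      coeff K q α + - coeff K q α   ≈⟨ -‿inverseʳ _ ⟩
      0#                            ∎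

  -- Images of monomials as sums of points

  lookup-exponentImage-∷ : ∀ a (A : Vec (Vec ℤ n) m) k α i →
    lookup (exponentImage K (a ∷ A) (k ∷ α)) i ≡ + k ℤ.* lookup a i ℤ.+ lookup (exponentImage K A α) i
  lookup-exponentImage-∷ a A k α i =
    trans (Vecₚ.lookup-zipWith ℤ._+_ i (Vec.map (+ k ℤ.*_) a) (exponentImage K A α))
          (cong (ℤ._+ _) (Vecₚ.lookup-map i (+ k ℤ.*_) a))

  lookup-exponentImage-𝟘 : (A : Vec (Vec ℤ n) m) → ∀ i → lookup (exponentImage K A 𝟘) i ≡ 0ℤ
  lookup-exponentImage-𝟘 []      i = Vecₚ.lookup-replicate i 0ℤ
  lookup-exponentImage-𝟘 (a ∷ A) i =
    trans (lookup-exponentImage-∷ a A 0 𝟘 i) (cong (ℤ._+_ 0ℤ) (lookup-exponentImage-𝟘 A i))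

  lookup-exponentImage-unit : (A : Vec (Vec ℤ n) m) → ∀ j i →
    lookup (exponentImage K A (unit j)) i ≡ ptⱽ A j i
  lookup-exponentImage-unit (a ∷ A) Fin.zero i = trans (lookup-exponentImage-∷ a A 1 𝟘 i)
    (trans (cong₂ ℤ._+_ (ℤₚ.*-identityˡ (lookup a i)) (lookup-exponentImage-𝟘 A i)) (ℤₚ.+-identityʳ _))
  lookup-exponentImage-unit (a ∷ A) (Fin.suc j) i = trans (lookup-exponentImage-∷ a A 0 (unit j) i)
    (trans (ℤₚ.+-identityˡ _) (lookup-exponentImage-unit A j i))

  lookup-exponentImage-⊕ : (A : Vec (Vec ℤ n) m) (α β : Vec ℕ m) → ∀ i →
    lookup (exponentImage K A (α ⊕ β)) i ≡ lookup (exponentImage K A α) i ℤ.+ lookup (exponentImage K A β) i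
  lookup-exponentImage-⊕ [] [] [] i =
    trans (Vecₚ.lookup-replicate i 0ℤ)
      (sym (cong₂ ℤ._+_ (Vecₚ.lookup-replicate i 0ℤ) (Vecₚ.lookup-replicate i 0ℤ)))
  lookup-exponentImage-⊕ (a ∷ A) (j ∷ α) (k ∷ β) i = ≡.begin
    lookup (exponentImage K (a ∷ A) (j ℕ.+ k ∷ α ⊕ β)) i ≡.≡⟨ lookup-exponentImage-∷ a A (j ℕ.+ k) (α ⊕ β) i ⟩
    + (j ℕ.+ k) ℤ.* x ℤ.+ lookup (exponentImage K A (α ⊕ β)) i
      ≡.≡⟨ cong₂ ℤ._+_ (ℤₚ.*-distribʳ-+ x (+ j) (+ k)) (lookup-exponentImage-⊕ A α β i) ⟩
    (+ j ℤ.* x ℤ.+ + k ℤ.* x) ℤ.+ (lookup (exponentImage K A α) i ℤ.+ lookup (exponentImage K A β) i)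
      ≡.≡⟨ ℤ-interchange (+ j ℤ.* x) _ _ _ ⟩
    (+ j ℤ.* x ℤ.+ lookup (exponentImage K A α) i) ℤ.+ (+ k ℤ.* x ℤ.+ lookup (exponentImage K A β) i)
      ≡.≡⟨ cong₂ ℤ._+_ (lookup-exponentImage-∷ a A j α i) (lookup-exponentImage-∷ a A k β i) ⟨
    lookup (exponentImage K (a ∷ A) (j ∷ α)) i ℤ.+ lookup (exponentImage K (a ∷ A) (k ∷ β)) i ≡.∎
    where
    module ≡ = ≡-Reasoning
    open CommutativeSemigroupProperties ℤₚ.+-commutativeSemigroup
      using () renaming (interchange to ℤ-interchange)
    x = lookup a i

  lookup-exponentImage-monomial : (A : Vec (Vec ℤ n) m) → ∀ l i →
    lookup (exponentImage K A (monomial l)) i ≡ total (ptⱽ A) l i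
  lookup-exponentImage-monomial A []      i = lookup-exponentImage-𝟘 A i
  lookup-exponentImage-monomial A (j ∷ l) i = trans (lookup-exponentImage-⊕ A (unit j) (monomial l) i)
    (cong₂ ℤ._+_ (lookup-exponentImage-unit A j i) (lookup-exponentImage-monomial A l i))

  -- Quadratic generation gives connectedness

  module Toric {n m} (A : Vec (Vec ℤ n) m) where

    E : Vec ℕ m → Vec ℤ n
    E = exponentImage K A

    infix 4 _≈ᴬ_
    _≈ᴬ_ : Vec ℕ m → Vec ℕ m → Set
    μ ≈ᴬ ν = E μ ≡ E ν × Vec.sum μ ≡ Vec.sum ν

    _≈ᴬ?_ : ∀ μ ν → Dec (μ ≈ᴬ ν)
    μ ≈ᴬ? ν = Vecₚ.≡-dec ℤ._≟_ (E μ) (E ν) ×-dec (Vec.sum μ ℕ.≟ Vec.sum ν)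

    ≈ᴬ-sym : ∀ μ ν → μ ≈ᴬ ν → ν ≈ᴬ μ
    ≈ᴬ-sym _ _ (p , q) = sym p , sym q

    ≈ᴬ-trans : ∀ {μ ν ξ} → μ ≈ᴬ ν → ν ≈ᴬ ξ → μ ≈ᴬ ξ
    ≈ᴬ-trans (p , q) (p' , q') = trans p p' , trans q q'

    fibre : Vec ℕ m → Vec ℕ m → Bool
    fibre ν μ = does (μ ≈ᴬ? ν)

    toric⇒fibre : ∀ p → InToricIdeal K A p → ∀ ν → weight (fibre ν) p ≈ 0#
    toric⇒fibre p t ν = t (E ν) (Vec.sum ν)

    binomial∈toric : ∀ c α β → α ≈ᴬ β → InToricIdeal K A ((c , α) ∷ (- c , β) ∷ [])
    binomial∈toric c α β (e , s) b d rewrite e | s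
      with does (Vecₚ.≡-dec ℤ._≟_ (E β) b) ∧ does (Vec.sum β ℕ.≟ d)
    ... | true  = F.trans (+-cong F.refl (+-identityʳ _)) (-‿inverseʳ c)
    ... | false = F.refl

    Linked : Vec ℕ m → Vec ℕ m → Set
    Linked α β = ptⱽ A ⊢ indices α ∼ indices β

    monomial-≈ᴬ : ∀ l l' → length l ≡ length l' → (∀ i → total (ptⱽ A) l i ≡ total (ptⱽ A) l' i) →
                  monomial l ≈ᴬ monomial l'
    monomial-≈ᴬ l l' len tot =
      lookup-ext (λ i → trans (lookup-exponentImage-monomial A l i)
                          (trans (tot i) (sym (lookup-exponentImage-monomial A l' i)))) ,
      trans (sum-monomial l) (trans len (sym (sum-monomial l')))

    length-indices : (α : Vec ℕ m) → length (indices α) ≡ Vec.sum α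
    length-indices α = trans (sym (sum-monomial (indices α))) (cong Vec.sum (monomial-indices α))

    total-indices : ∀ α i → total (ptⱽ A) (indices α) i ≡ lookup (E α) i
    total-indices α i = trans (sym (lookup-exponentImage-monomial A (indices α) i))
                              (cong (λ β → lookup (E β) i) (monomial-indices α))

    -- Each of u and v spells out to two variables, with equal sums, so one `move` joins them; the
    -- variables of γ form the untouched tail.
    quadratic-edge : ∀ γ {u v} → Vec.sum u ≡ 2 → u ≈ᴬ v → Linked (γ ⊕ u) (γ ⊕ v)
    quadratic-edge γ {u} {v} deg (e , s) = ∼-sym (reorder u) ⨾
      pairs (indices u) (indices v) (trans (length-indices u) deg)
            (trans (length-indices v) (trans (sym s) deg))
            (λ i → trans (total-indices u i) (trans (cong (λ b → lookup b i) e) (sym (total-indices v i))))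
      ⨾ reorder v
      where
      reorder : ∀ w → ptⱽ A ⊢ indices w ++ indices γ ∼ indices (γ ⊕ w)
      reorder w = ∼-sym (↭⇒∼ (↭-trans
        (↭-reflexive (cong indices (trans (⊕-comm γ w) (cong (_⊕ γ) (sym (monomial-indices w))))))
        (indices-monomial-⊕ (indices w) γ)))
      pairs : ∀ l l' → length l ≡ 2 → length l' ≡ 2 →
              (∀ i → total (ptⱽ A) l i ≡ total (ptⱽ A) l' i) → ptⱽ A ⊢ l ++ indices γ ∼ l' ++ indices γ
      pairs (a ∷ b ∷ []) (c ∷ d ∷ []) refl refl tot = move (indices γ) λ i →
        trans (cong (ℤ._+_ (ptⱽ A a i)) (sym (ℤₚ.+-identityʳ _)))
          (trans (tot i) (cong (ℤ._+_ (ptⱽ A c i)) (ℤₚ.+-identityʳ _)))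

    -- Only finitely many links es are used, so that the classes they generate are
    -- decidable and give functionals φ.
    Killed : Poly K m → Set ℓ
    Killed p = ∃ λ (es : List (Vec ℕ m × Vec ℕ m)) → All (λ (x , y) → Linked x y) es ×
      (∀ (φ : Vec ℕ m → Bool) → All (λ (x , y) → φ x ≡ φ y) es → weight φ p ≈ 0#)

    Killed-++ : ∀ (p q : Poly K m) → Killed p → Killed q → Killed (p ++ q)
    Killed-++ p q (es , r , k) (fs , s , l) = es ++ fs , Allₚ.++⁺ r s , λ φ e →
      F.trans (weight-++ φ p q)
        (F.trans (+-cong (k φ (Allₚ.++⁻ˡ es e)) (l φ (Allₚ.++⁻ʳ es e))) (+-identityˡ 0#))

    -- The coefficients a and b are arbitrary. If u and v have the same image, the toric condition
    -- gives a + b = 0 and the two monomials are linked; otherwise it gives a = b = 0, and the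
    -- product vanishes under every φ.
    Killed-term : ∀ c γ {g} → IsQuadraticBinomial K g → InToricIdeal K A g →
                  Killed (map (λ t → c * proj₁ t , γ ⊕ proj₂ t) g)
    Killed-term c γ (a , b , u , v , deg-u , deg-v , refl) toric with u ≈ᴬ? v
    ... | yes u≈v = (γ ⊕ u , γ ⊕ v) ∷ [] , quadratic-edge γ deg-u u≈v ∷ [] , λ { φ (e ∷ []) → kill φ e }
      where
      a+b≈0 : a + b ≈ 0#
      a+b≈0 = F.trans (+-cong F.refl (F.sym (+-identityʳ b)))
        (F.trans (F.reflexive both) (toric⇒fibre ((a , u) ∷ (b , v) ∷ []) toric v))
        where
        both : a + (b + 0#) ≡ weight (fibre v) ((a , u) ∷ (b , v) ∷ [])
        both rewrite dec-true (u ≈ᴬ? v) u≈v | dec-true (v ≈ᴬ? v) (refl , refl) = refl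
      kill : ∀ (φ : Vec ℕ m → Bool) → φ (γ ⊕ u) ≡ φ (γ ⊕ v) →
             weight φ ((c * a , γ ⊕ u) ∷ (c * b , γ ⊕ v) ∷ []) ≈ 0#
      kill φ e rewrite e with φ (γ ⊕ v)
      ... | false = F.refl
      ... | true  = begin
        c * a + (c * b + 0#) ≈⟨ +-cong F.refl (+-identityʳ _) ⟩
        c * a + c * b        ≈⟨ distribˡ c a b ⟨
        c * (a + b)          ≈⟨ *-cong F.refl a+b≈0 ⟩
        c * 0#               ≈⟨ zeroʳ c ⟩
        0#                   ∎
    ... | no u≉v = [] , [] , λ φ _ → kill φ
      where
      a≈0 : a ≈ 0#
      a≈0 = F.trans (F.sym (+-identityʳ a))
        (F.trans (F.reflexive only) (toric⇒fibre ((a , u) ∷ (b , v) ∷ []) toric u))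
        where
        only : a + 0# ≡ weight (fibre u) ((a , u) ∷ (b , v) ∷ [])
        only rewrite dec-true (u ≈ᴬ? u) (refl , refl) | dec-false (v ≈ᴬ? u) (u≉v ∘ ≈ᴬ-sym v u) = refl
      b≈0 : b ≈ 0#
      b≈0 = F.trans (F.sym (+-identityʳ b))
        (F.trans (F.reflexive only) (toric⇒fibre ((a , u) ∷ (b , v) ∷ []) toric v))
        where
        only : b + 0# ≡ weight (fibre v) ((a , u) ∷ (b , v) ∷ [])
        only rewrite dec-true (v ≈ᴬ? v) (refl , refl) | dec-false (u ≈ᴬ? v) u≉v = refl
      vanish : ∀ (φ : Vec ℕ m → Bool) μ {x s} → x ≈ 0# → s ≈ 0# → (if φ μ then c * x + s else s) ≈ 0#
      vanish φ μ x≈0 s≈0 with φ μ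
      ... | false = s≈0
      ... | true  = F.trans (+-cong (F.trans (*-cong F.refl x≈0) (zeroʳ c)) s≈0) (+-identityˡ 0#)
      kill : ∀ (φ : Vec ℕ m → Bool) → weight φ ((c * a , γ ⊕ u) ∷ (c * b , γ ⊕ v) ∷ []) ≈ 0#
      kill φ = vanish φ (γ ⊕ u) a≈0 (vanish φ (γ ⊕ v) b≈0 F.refl)

    Killed-[] : Killed []
    Killed-[] = [] , [] , λ _ _ → F.refl

    Killed-*ₚ : ∀ h {g} → IsQuadraticBinomial K g → InToricIdeal K A g → Killed (_*ₚ_ K h g)
    Killed-*ₚ []            quad toric = Killed-[]
    Killed-*ₚ ((c , γ) ∷ h) {g} quad toric =
      Killed-++ (map (λ t → c * proj₁ t , γ ⊕ proj₂ t) g) (_*ₚ_ K h g)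
        (Killed-term c γ quad toric) (Killed-*ₚ h quad toric)

    Killed⇒Linked : ∀ α β q → Killed q → _≈ₚ_ K ((1# , α) ∷ (- 1# , β) ∷ []) q → Linked α β
    Killed⇒Linked α β q (es , es-linked , kill) p≈q =
      decide (Vecₚ.≡-dec ℕ._≟_ (representative β) (representative α))
      where
      open UnionFind (Vecₚ.≡-dec ℕ._≟_) {Linked} (λ γ → ∼-refl (indices γ)) ∼-sym _⨾_
      representative : Vec ℕ m → Vec ℕ m
      representative = proj₁ (representatives es es-linked)
      rep-linked : ∀ γ → Linked γ (representative γ)
      rep-linked = proj₁ (proj₂ (representatives es es-linked))
      -- The indicator of the class of α. It is constant along the links `es`, so q has weight 0,
      -- while x^α - x^β would have weight 1 if β lay outside the class.
      φ : Vec ℕ m → Bool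
      φ μ = does (Vecₚ.≡-dec ℕ._≟_ (representative μ) (representative α))
      decide : Dec (representative β ≡ representative α) → Linked α β
      decide (yes e) = rep-linked α ⨾ subst (λ γ → Linked γ β) e (∼-sym (rep-linked β))
      decide (no ≢)  = contradiction (begin
        1#           ≈⟨ +-identityʳ 1# ⟨
        1# + 0#      ≈⟨ F.reflexive only ⟩
        weight φ ((1# , α) ∷ (- 1# , β) ∷ []) ≈⟨ weight-resp-≈ₚ ((1# , α) ∷ (- 1# , β) ∷ []) q p≈q φ ⟩
        weight φ q   ≈⟨ kill φ (All.map (cong λ γ → does (Vecₚ.≡-dec ℕ._≟_ γ (representative α)))
                                  (proj₂ (proj₂ (representatives es es-linked)))) ⟩
        0#           ∎) 1≉0
        where
        only : 1# + 0# ≡ weight φ ((1# , α) ∷ (- 1# , β) ∷ [])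
        only rewrite dec-true (Vecₚ.≡-dec ℕ._≟_ (representative α) (representative α)) refl
                   | dec-false (Vecₚ.≡-dec ℕ._≟_ (representative β) (representative α)) ≢ = refl

    combination : List (Poly K m × Poly K m) → Poly K m
    combination = concatMap (λ hg → _*ₚ_ K (proj₁ hg) (proj₂ hg))

    generated⇒connected : GeneratedByQuadraticBinomials K A → Connected (ptⱽ A)
    generated⇒connected (G , quad , toric , generates) l l' len tot =
      let hgs , hgs∈ , p≈ = generates ((1# , monomial l) ∷ (- 1# , monomial l') ∷ [])
            (binomial∈toric 1# (monomial l) (monomial l') (monomial-≈ᴬ l l' len tot))
      in ∼-sym (↭⇒∼ (indices-monomial l)) ⨾
         Killed⇒Linked (monomial l) (monomial l') (combination hgs) (killed hgs hgs∈) p≈ ⨾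
         ↭⇒∼ (indices-monomial l')
      where
      killed : ∀ hgs → All (λ hg → proj₂ hg ∈ G) hgs → Killed (combination hgs)
      killed []              []         = Killed-[]
      killed ((h , g) ∷ hgs) (g∈G ∷ gs) =
        Killed-++ (_*ₚ_ K h g) (combination hgs)
          (Killed-*ₚ h (All.lookup quad g∈G) (All.lookup toric g∈G)) (killed hgs gs)

    -- Connectedness gives quadratic generation

    quadratics : List (Vec ℕ m)
    quadratics = cartesianProductWith (λ i j → unit i ⊕ unit j) (allFin m) (allFin m)

    unit⊕unit∈quadratics : ∀ i j → unit i ⊕ unit j ∈ quadratics
    unit⊕unit∈quadratics i j = ∈-cartesianProductWith⁺ (λ i j → unit i ⊕ unit j) (∈-allFin i) (∈-allFin j)

    sum-quadratic : ∀ {u} → u ∈ quadratics → Vec.sum u ≡ 2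
    sum-quadratic u∈
      with i , j , _ , _ , refl ←
        ∈-cartesianProductWith⁻ (λ i j → unit i ⊕ unit j) (allFin m) (allFin m) u∈ =
      trans (sum-⊕ (unit i) (unit j)) (cong₂ ℕ._+_ (sum-unit i) (sum-unit j))

    -- The junk case u − u keeps the family in the toric ideal.
    target : Vec ℕ m → Vec ℕ m → Vec ℕ m
    target u v = if does (u ≈ᴬ? v) then v else u

    binomial : Vec ℕ m → Vec ℕ m → Poly K m
    binomial u v = (1# , u) ∷ (- 1# , target u v) ∷ []

    generators : List (Poly K m)
    generators = cartesianProductWith binomial quadratics quadratics

    target-≈ᴬ : ∀ u v → u ≈ᴬ target u v
    target-≈ᴬ u v = choose (u ≈ᴬ? v)
      where
      choose : (d : Dec (u ≈ᴬ v)) → u ≈ᴬ (if does d then v else u)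
      choose (yes u≈v) = u≈v
      choose (no  _)   = refl , refl

    target-∈ : ∀ u v → u ∈ quadratics → v ∈ quadratics → target u v ∈ quadratics
    target-∈ u v u∈ v∈ with does (u ≈ᴬ? v)
    ... | true  = v∈
    ... | false = u∈

    generator-quadratic : ∀ {g} → g ∈ generators → IsQuadraticBinomial K g
    generator-quadratic g∈
      with u , v , u∈ , v∈ , refl ← ∈-cartesianProductWith⁻ binomial quadratics quadratics g∈ =
      1# , - 1# , u , target u v , sum-quadratic u∈ , sum-quadratic (target-∈ u v u∈ v∈) , refl

    generator-toric : ∀ {g} → g ∈ generators → InToricIdeal K A g
    generator-toric g∈
      with u , v , _ , _ , refl ← ∈-cartesianProductWith⁻ binomial quadratics quadratics g∈ =
      binomial∈toric 1# u (target u v) (target-≈ᴬ u v)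

    Ideal : Poly K m → Set (c ⊔ ℓ)
    Ideal = InIdealGen K generators

    combination-++ : ∀ xs ys → combination (xs ++ ys) ≡ combination xs ++ combination ys
    combination-++ = concatMap-++ (λ hg → _*ₚ_ K (proj₁ hg) (proj₂ hg))

    Ideal-resp : ∀ p q → _≈ₚ_ K p q → Ideal q → Ideal p
    Ideal-resp p q p≈q (hgs , ∈G , q≈) = hgs , ∈G , λ α → F.trans (p≈q α) (q≈ α)

    Ideal-++ : ∀ p q → Ideal p → Ideal q → Ideal (p ++ q)
    Ideal-++ p q (xs , xs∈ , p≈) (ys , ys∈ , q≈) = xs ++ ys , Allₚ.++⁺ xs∈ ys∈ , λ α → begin
      coeff K (p ++ q) α                                      ≈⟨ weight-++ (coefficient α) p q ⟩
      coeff K p α + coeff K q α                               ≈⟨ +-cong (p≈ α) (q≈ α) ⟩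
      coeff K (combination xs) α + coeff K (combination ys) α
        ≈⟨ weight-++ (coefficient α) (combination xs) (combination ys) ⟨
      coeff K (combination xs ++ combination ys) α
        ≈⟨ F.reflexive (cong (λ r → coeff K r α) (combination-++ xs ys)) ⟨
      coeff K (combination (xs ++ ys)) α                      ∎

    difference : Carrier → Vec ℕ m → Vec ℕ m → Poly K m
    difference c α β = (c , α) ∷ (- c , β) ∷ []

    weight-difference : ∀ φ c α β → weight φ (difference c α β) ≈
      (if φ α then c else 0#) + - (if φ β then c else 0#)
    weight-difference φ c α β with φ α | φ β
    ... | true  | true  = +-cong F.refl (+-identityʳ _)
    ... | true  | false = +-cong F.refl (F.sym -0#≈0#)
    ... | false | true  = F.trans (+-identityʳ _) (F.sym (+-identityˡ _))
    ... | false | false = F.sym (-‿inverseʳ 0#)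

    -- Quantifying over c builds scalar multiples in, so closing `Ideal` under sums suffices for
    -- reducing a polynomial term by term.
    Congruent : Vec ℕ m → Vec ℕ m → Set (c ⊔ ℓ)
    Congruent α β = ∀ c → Ideal (difference c α β)

    Congruent-refl : ∀ α → Congruent α α
    Congruent-refl α c = [] , [] , λ ν →
      F.trans (weight-difference (coefficient ν) c α α) (-‿inverseʳ _)

    Congruent-trans : ∀ α β γ → Congruent α β → Congruent β γ → Congruent α γ
    Congruent-trans α β γ p q c =
      Ideal-resp (difference c α γ) (difference c α β ++ difference c β γ) telescope
        (Ideal-++ (difference c α β) (difference c β γ) (p c) (q c))
      where
      telescope : _≈ₚ_ K (difference c α γ) (difference c α β ++ difference c β γ)
      telescope ν = begin
        coeff K (difference c α γ) ν ≈⟨ weight-difference φ c α γ ⟩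
        x + - z                      ≈⟨ +-cong (+-identityʳ x) F.refl ⟨
        x + 0# + - z                 ≈⟨ +-cong (+-cong F.refl (-‿inverseˡ y)) F.refl ⟨
        x + (- y + y) + - z          ≈⟨ +-cong (+-assoc x (- y) y) F.refl ⟨
        x + - y + y + - z            ≈⟨ +-assoc (x + - y) y (- z) ⟩
        (x + - y) + (y + - z)        ≈⟨ +-cong (weight-difference φ c α β) (weight-difference φ c β γ) ⟨
        weight φ (difference c α β) + weight φ (difference c β γ)
          ≈⟨ weight-++ φ (difference c α β) (difference c β γ) ⟨
        weight φ (difference c α β ++ difference c β γ) ∎
        where
        φ = coefficient ν
        x = if φ α then c else 0#
        y = if φ β then c else 0#
        z = if φ γ then c else 0#

    Congruent-move : ∀ γ {u v} → u ∈ quadratics → v ∈ quadratics → u ≈ᴬ v → Congruent (γ ⊕ u) (γ ⊕ v)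
    Congruent-move γ {u} {v} u∈ v∈ u≈v c =
      (((c , γ) ∷ []) , binomial u v) ∷ [] , ∈-cartesianProductWith⁺ binomial u∈ v∈ ∷ [] , same
      where
      target≡ : target u v ≡ v
      target≡ rewrite dec-true (u ≈ᴬ? v) u≈v = refl
      same : _≈ₚ_ K (difference c (γ ⊕ u) (γ ⊕ v)) ((c * 1# , γ ⊕ u) ∷ (c * - 1# , γ ⊕ target u v) ∷ [])
      same ν rewrite target≡ with coefficient ν (γ ⊕ u) | coefficient ν (γ ⊕ v)
      ... | a | b = scaled a b
        where
        c≈ : c ≈ c * 1#
        c≈ = F.sym (*-identityʳ c)
        -c≈ : - c ≈ c * - 1#
        -c≈ = F.trans (-‿cong c≈) (-‿distribʳ-* c 1#)
        scaled : ∀ a b → (if a then c + (if b then - c + 0# else 0#) else (if b then - c + 0# else 0#)) ≈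
          (if a then c * 1# + (if b then c * - 1# + 0# else 0#) else (if b then c * - 1# + 0# else 0#))
        scaled true  true  = +-cong c≈ (+-cong -c≈ F.refl)
        scaled true  false = +-cong c≈ F.refl
        scaled false true  = +-cong -c≈ F.refl
        scaled false false = F.refl

    -- The factor γ collects the heads passed by `cons`, so that a `move` deep in the list becomes a
    -- multiple of a quadratic binomial. Injectivity turns equal points into the same variable;
    -- otherwise x_i - x_j would be a linear element of the toric ideal, out of reach of quadratic
    -- generators.
    ∼⇒Congruent : (∀ i j → (∀ k → ptⱽ A i k ≡ ptⱽ A j k) → i ≡ j) → ∀ {l l'} → ptⱽ A ⊢ l ∼ l' →
                  ∀ γ → Congruent (γ ⊕ monomial l) (γ ⊕ monomial l')
    ∼⇒Congruent inj nil γ = Congruent-refl (γ ⊕ 𝟘)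
    ∼⇒Congruent inj (cons {x} {y} {l} {l'} e p) γ with refl ← inj x y e =
      subst₂ Congruent (⊕-assoc γ (unit x) (monomial l)) (⊕-assoc γ (unit x) (monomial l'))
        (∼⇒Congruent inj p (γ ⊕ unit x))
    ∼⇒Congruent inj (move {x} {y} {u} {v} l e) γ =
      subst₂ Congruent (regroup x y) (regroup u v)
        (Congruent-move (γ ⊕ monomial l) (unit⊕unit∈quadratics x y) (unit⊕unit∈quadratics u v) same)
      where
      regroup : ∀ i j → γ ⊕ monomial l ⊕ (unit i ⊕ unit j) ≡ γ ⊕ (unit i ⊕ (unit j ⊕ monomial l))
      regroup i j = trans (⊕-assoc γ (monomial l) _)
        (cong (γ ⊕_) (trans (⊕-comm (monomial l) _) (⊕-assoc (unit i) (unit j) (monomial l))))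
      image : ∀ i j k → lookup (E (unit i ⊕ unit j)) k ≡ ptⱽ A i k ℤ.+ ptⱽ A j k
      image i j k = trans (lookup-exponentImage-⊕ A (unit i) (unit j) k)
        (cong₂ ℤ._+_ (lookup-exponentImage-unit A i k) (lookup-exponentImage-unit A j k))
      same : unit x ⊕ unit y ≈ᴬ unit u ⊕ unit v
      same = lookup-ext (λ k → trans (image x y k) (trans (e k) (sym (image u v k)))) ,
             trans (sum-quadratic (unit⊕unit∈quadratics x y))
               (sym (sum-quadratic (unit⊕unit∈quadratics u v)))
    ∼⇒Congruent inj (_⨾_ {l} {l'} {l″} p q) γ =
      Congruent-trans (γ ⊕ monomial l) (γ ⊕ monomial l') (γ ⊕ monomial l″)
        (∼⇒Congruent inj p γ) (∼⇒Congruent inj q γ)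

    -- `M` will be the list of monomials of the polynomial at hand, so a common representative is
    -- found by search. The default μ occurs only for fibres that miss `M`.
    representative : List (Vec ℕ m) → Vec ℕ m → Vec ℕ m
    representative []      μ = μ
    representative (ν ∷ M) μ = if does (ν ≈ᴬ? μ) then ν else representative M μ

    rep-≈ᴬ : ∀ M μ → representative M μ ≈ᴬ μ
    rep-≈ᴬ []      μ = refl , refl
    rep-≈ᴬ (ν ∷ M) μ = choose (ν ≈ᴬ? μ)
      where
      choose : (d : Dec (ν ≈ᴬ μ)) → (if does d then ν else representative M μ) ≈ᴬ μ
      choose (yes e) = e
      choose (no  _) = rep-≈ᴬ M μ

    -- `μ ∈ M` ensures that the search succeeds; the default would return μ and ν unchanged.
    rep-cong : ∀ {M μ ν} → μ ≈ᴬ ν → μ ∈ M → representative M μ ≡ representative M ν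
    rep-cong {x ∷ M} {μ} {ν} e μ∈ = choose μ∈ (x ≈ᴬ? μ) (x ≈ᴬ? ν)
      where
      choose : μ ∈ x ∷ M → (d : Dec (x ≈ᴬ μ)) (d' : Dec (x ≈ᴬ ν)) →
               (if does d then x else representative M μ) ≡ (if does d' then x else representative M ν)
      choose _           (yes _) (yes _) = refl
      choose _           (yes p) (no ¬q) = contradiction (≈ᴬ-trans {x} {μ} {ν} p e) ¬q
      choose _           (no ¬p) (yes q) = contradiction (≈ᴬ-trans {x} {ν} {μ} q (≈ᴬ-sym μ ν e)) ¬p
      choose (here refl) (no ¬p) (no _)  = contradiction (refl , refl) ¬p
      choose (there μ∈)  (no _)  (no _)  = rep-cong e μ∈

    reduce : (Vec ℕ m → Vec ℕ m) → Poly K m → Poly K m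
    reduce f = concatMap (λ t → difference (proj₁ t) (proj₂ t) (f (proj₂ t)))

    -- `weight (φ ∘ f) p` is the φ-weight of p with every monomial μ replaced by f μ; `reduce`
    -- collects the differences made by that replacement.
    weight-reduce : ∀ f φ p → weight φ p ≈ weight φ (reduce f p) + weight (φ ∘ f) p
    weight-reduce f φ []            = F.sym (+-identityˡ 0#)
    weight-reduce f φ ((c , μ) ∷ p) = begin
      (if φ μ then c + weight φ p else weight φ p) ≈⟨ pull (φ μ) (weight φ p) ⟩
      x + weight φ p                               ≈⟨ +-cong (cancel-y) (weight-reduce f φ p) ⟩
      ((x + - y) + y) + (weight φ (reduce f p) + weight (φ ∘ f) p) ≈⟨ interchange _ _ _ _ ⟩
      ((x + - y) + weight φ (reduce f p)) + (y + weight (φ ∘ f) p)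
        ≈⟨ +-cong (F.trans (weight-++ φ (difference c μ (f μ)) (reduce f p))
                           (+-cong (weight-difference φ c μ (f μ)) F.refl))
                  (pull (φ (f μ)) (weight (φ ∘ f) p)) ⟨
      weight φ (reduce f ((c , μ) ∷ p)) + weight (φ ∘ f) ((c , μ) ∷ p) ∎
      where
      x = if φ μ then c else 0#
      y = if φ (f μ) then c else 0#
      pull : ∀ b s → (if b then c + s else s) ≈ (if b then c else 0#) + s
      pull true  s = F.refl
      pull false s = F.sym (+-identityˡ s)
      cancel-y : x ≈ (x + - y) + y
      cancel-y = F.sym (F.trans (+-assoc x (- y) y) (F.trans (+-cong F.refl (-‿inverseˡ y)) (+-identityʳ x)))

    -- If ν represents its own fibre, the terms sent to ν are exactly those of p in that fibre, and
    -- their sum is a coefficient of the image of p. If not, no term is sent to ν.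
    toric⇒reps-vanish : ∀ p → InToricIdeal K A p → let M = map proj₂ p in
                        ∀ ν → weight (coefficient ν ∘ representative M) p ≈ 0#
    toric⇒reps-vanish p toric ν with Vecₚ.≡-dec ℕ._≟_ (representative (map proj₂ p) ν) ν
    ... | yes fixed = F.trans
      (F.reflexive (weight-cong p (All.tabulate λ {t} t∈p → agree (proj₂ t) (∈-map⁺ proj₂ t∈p))))
      (toric⇒fibre p toric ν)
      where
      M = map proj₂ p
      agree : ∀ μ → μ ∈ M → coefficient ν (representative M μ) ≡ fibre ν μ
      agree μ μ∈ = choose (μ ≈ᴬ? ν)
        where
        choose : (d : Dec (μ ≈ᴬ ν)) → coefficient ν (representative M μ) ≡ does d
        choose (yes e) = dec-true (Vecₚ.≡-dec ℕ._≟_ (representative M μ) ν) (trans (rep-cong e μ∈) fixed)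
        choose (no ¬e) = dec-false (Vecₚ.≡-dec ℕ._≟_ (representative M μ) ν)
                      λ r≡ν → ¬e (subst (μ ≈ᴬ_) r≡ν (≈ᴬ-sym (representative M μ) μ (rep-≈ᴬ M μ)))
    ... | no moved = F.reflexive (trans
          (weight-cong {φ = coefficient ν ∘ representative M} {ψ = λ _ → false} p
            (All.tabulate λ {t} t∈p → dec-false (Vecₚ.≡-dec ℕ._≟_ (representative M (proj₂ t)) ν)
              (never (proj₂ t) (∈-map⁺ proj₂ t∈p))))
          (weight-false p))
      where
      M = map proj₂ p
      never : ∀ μ → μ ∈ M → ¬ (representative M μ ≡ ν)
      never μ μ∈ refl = moved (sym (rep-cong (≈ᴬ-sym (representative M μ) μ (rep-≈ᴬ M μ)) μ∈))

    connected⇒generated : (∀ i j → (∀ k → ptⱽ A i k ≡ ptⱽ A j k) → i ≡ j) →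
                          Connected (ptⱽ A) → GeneratedByQuadraticBinomials K A
    connected⇒generated inj conn =
      generators , All.tabulate generator-quadratic , All.tabulate generator-toric , λ p toric →
      -- Nothing survives on the representatives, so p equals its own `reduce`, a sum of differences
      -- of monomials with equal image.
      Ideal-resp p (reduce (representative (map proj₂ p)) p)
        (λ ν → F.trans (weight-reduce (representative (map proj₂ p)) (coefficient ν) p)
                 (F.trans (+-cong F.refl (toric⇒reps-vanish p toric ν)) (+-identityʳ _)))
        (reduce∈ (map proj₂ p) p)
      where
      congruent : ∀ α β → α ≈ᴬ β → Congruent α β
      congruent α β (e , s) =
        subst₂ Congruent (back α) (back β)
          (∼⇒Congruent inj (conn (indices α) (indices β)
            (trans (length-indices α) (trans s (sym (length-indices β))))
            (λ i → trans (total-indices α i) (trans (cong (λ b → lookup b i) e)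
                                              (sym (total-indices β i))))) 𝟘)
        where
        back : ∀ γ → 𝟘 ⊕ monomial (indices γ) ≡ γ
        back γ = trans (⊕-identityˡ _) (monomial-indices γ)
      -- `M` remains the monomial list of the whole polynomial while the recursion runs down the
      -- terms.
      reduce∈ : ∀ M p → Ideal (reduce (representative M) p)
      reduce∈ M []            = [] , [] , λ _ → F.refl
      reduce∈ M ((c , μ) ∷ p) = Ideal-++ (difference c μ (representative M μ)) (reduce (representative M) p)
        (congruent μ (representative M μ) (≈ᴬ-sym (representative M μ) μ (rep-≈ᴬ M μ)) c) (reduce∈ M p)

-- Lattice points of an anti-blocking polytope and of its reflections

toℚ-mono : ∀ {z w} → z ℤ.≤ w → toℚ z ℚ.≤ toℚ w
-- `z / 1` is normalised and does not compute for a variable z; among unnormalised rationals the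
-- denominator 1 is visible.
toℚ-mono {z} {w} z≤w = ℚₚ.toℚᵘ-cancel-≤
  (ℚᵘₚ.≤-respˡ-≃ (ℚᵘₚ.≃-sym (ℚₚ.toℚᵘ-fromℚᵘ (ℚᵘ.mkℚᵘ z 0)))
    (ℚᵘₚ.≤-respʳ-≃ (ℚᵘₚ.≃-sym (ℚₚ.toℚᵘ-fromℚᵘ (ℚᵘ.mkℚᵘ w 0)))
      (ℚᵘ.*≤* (ℤₚ.*-monoʳ-≤-nonNeg (+ 1) z≤w))))

toℚ-cancel-0≤ : ∀ z → 0ℚ ℚ.≤ toℚ z → + 0 ℤ.≤ z
toℚ-cancel-0≤ z 0≤z with ℚᵘₚ.≤-respʳ-≃ (ℚₚ.toℚᵘ-fromℚᵘ (ℚᵘ.mkℚᵘ z 0)) (ℚₚ.toℚᵘ-mono-≤ 0≤z)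
... | ℚᵘ.*≤* p = subst₂ ℤ._≤_ refl (ℤₚ.*-identityʳ z) p

+∣∣ : ∀ {z} → + 0 ℤ.≤ z → + ∣ z ∣ ≡ z
+∣∣ = ℤₚ.0≤i⇒+∣i∣≡i

module _ {n k} (vs : Vec (Vec ℤ n) k) (anti : AntiBlocking vs) where

  T : (Fin n → ℕ) → Set
  T f = LatticePointOf vs (tabulate (+_ ∘ f))

  T-down : ∀ {f g} → T f → (∀ i → g i ≤ f i) → T g
  T-down {f} {g} t g≤f = proj₂ anti (toℚⁿ (tabulate (+_ ∘ f))) (toℚⁿ (tabulate (+_ ∘ g))) t
    (VecPointwise.map⁺ {_∼₁_ = λ x y → + 0 ℤ.≤ x × x ℤ.≤ y}
      (λ (0≤x , x≤y) → toℚ-mono 0≤x , toℚ-mono x≤y)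
      (VecPointwise.tabulate⁺ (λ i → ℤ.+≤+ ℕ.z≤n , ℤ.+≤+ (g≤f i))))

  open DownClosed T T-down

  lattice-nonneg : ∀ z → LatticePointOf vs z → ∀ i → + 0 ℤ.≤ lookup z i
  lattice-nonneg z z∈ i = toℚ-cancel-0≤ (lookup z i)
    (subst (0ℚ ℚ.≤_) (Vecₚ.lookup-map i toℚ z) (VecAllₚ.lookup⁺ (proj₁ anti (toℚⁿ z) z∈) i))

  lattice⇒T : ∀ z → LatticePointOf vs z → T (∣_∣ ∘ lookup z)
  lattice⇒T z z∈ = subst (LatticePointOf vs)
    (lookup-ext λ i → trans (sym (+∣∣ (lattice-nonneg z z∈ i))) (sym (Vecₚ.lookup∘tabulate _ i))) z∈

  lookup-applySigns : (ε : Vec Sign n) (z : Vec ℤ n) → ∀ i →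
    lookup (applySigns ε z) i ≡ (lookup ε i ◃ 1) ℤ.* lookup z i
  lookup-applySigns ε z i = Vecₚ.lookup-zipWith (λ s z → (s ◃ 1) ℤ.* z) i ε z

  -- A point of P has no negative coordinates, so εz = |εz| = |z|.
  lattice±⇒T : ∀ z → LatticePointOf± vs z → T (∣_∣ ∘ lookup z)
  lattice±⇒T z (ε , z∈) = T-down (lattice⇒T (applySigns ε z) z∈) λ i → ℕₚ.≤-reflexive (begin
    ∣ lookup z i ∣                       ≡⟨ ℕₚ.*-identityˡ _ ⟨
    1 ℕ.* ∣ lookup z i ∣                 ≡⟨ cong (ℕ._* ∣ lookup z i ∣) (ℤₚ.abs-◃ (lookup ε i) 1) ⟨
    ∣ lookup ε i ◃ 1 ∣ ℕ.* ∣ lookup z i ∣ ≡⟨ ℤₚ.abs-* (lookup ε i ◃ 1) (lookup z i) ⟨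
    ∣ (lookup ε i ◃ 1) ℤ.* lookup z i ∣  ≡⟨ cong ∣_∣ (lookup-applySigns ε z i) ⟨
    ∣ lookup (applySigns ε z) i ∣        ∎)
    where open ≡-Reasoning

  -- The signs of f themselves serve as ε, since multiplying an integer by its sign gives its
  -- absolute value.
  T⇒lattice± : ∀ f → T (∣_∣ ∘ f) → LatticePointOf± vs (tabulate f)
  T⇒lattice± f t = tabulate (sign ∘ f) , subst (LatticePointOf vs) (lookup-ext λ i → begin
    lookup (tabulate (+_ ∘ ∣_∣ ∘ f)) i
      ≡⟨ Vecₚ.lookup∘tabulate _ i ⟩
    + ∣ f i ∣
      ≡⟨ sign◃1*-self (f i) ⟨
    (sign (f i) ◃ 1) ℤ.* f i
      ≡⟨ cong₂ (λ s z → (s ◃ 1) ℤ.* z) (Vecₚ.lookup∘tabulate _ i) (Vecₚ.lookup∘tabulate f i) ⟨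
    (lookup (tabulate (sign ∘ f)) i ◃ 1) ℤ.* lookup (tabulate f) i
      ≡⟨ lookup-applySigns (tabulate (sign ∘ f)) (tabulate f) i ⟨
    lookup (applySigns (tabulate (sign ∘ f)) (tabulate f)) i ∎) t
    where
    open ≡-Reasoning
    sign◃1*-self : ∀ z → (sign z ◃ 1) ℤ.* z ≡ + ∣ z ∣
    sign◃1*-self (+ j)    = ℤₚ.*-identityˡ (+ j)
    sign◃1*-self -[1+ j ] = ℤₚ.-1*i≡-i -[1+ j ]

  module _ {m} (A : Vec (Vec ℤ n) m) where

    position : ∀ {z} → z Mem.∈ A → Σ (Fin m) λ j → ∀ i → ptⱽ A j i ≡ lookup z i
    position z∈ = Any.index z∈ , λ i → cong (λ w → lookup w i) (sym (Anyₚ.lookup-index z∈))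

    module _ (enum : Enumerates (LatticePointOf vs) A) where

      private
        point : Fin m → Pos
        point j = ∣_∣ ∘ ptⱽ A j , lattice⇒T _ (proj₂ (proj₂ enum _) (∈-lookup j A))
        point-pt : ∀ j i → ptᴾ (point j) i ≡ ptⱽ A j i
        point-pt j = +∣∣ ∘ lattice-nonneg _ (proj₂ (proj₂ enum _) (∈-lookup j A))
        index : (x : Pos) → Σ (Fin m) λ j → ∀ i → ptⱽ A j i ≡ ptᴾ x i
        index (f , t) = let j , e = position (proj₁ (proj₂ enum _) t)
                        in j , λ i → trans (e i) (Vecₚ.lookup∘tabulate _ i)

      Connected⇒Connectedᴾ : Connected (ptⱽ A) → Connected ptᴾ
      Connected⇒Connectedᴾ = Connected-transport point point-pt (proj₁ ∘ index) (proj₂ ∘ index)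

      Connectedᴾ⇒Connected : Connected ptᴾ → Connected (ptⱽ A)
      Connectedᴾ⇒Connected = Connected-transport (proj₁ ∘ index) (proj₂ ∘ index) point point-pt

    module _ (enum : Enumerates (LatticePointOf± vs) A) where

      private
        point : Fin m → Signed
        point j = ptⱽ A j , lattice±⇒T _ (proj₂ (proj₂ enum _) (∈-lookup j A))
        index : (x : Signed) → Σ (Fin m) λ j → ∀ i → ptⱽ A j i ≡ ptˢ x i
        index (f , t) = let j , e = position (proj₁ (proj₂ enum _) (T⇒lattice± f t))
                        in j , λ i → trans (e i) (Vecₚ.lookup∘tabulate f i)

      Connected⇒Connectedˢ : Connected (ptⱽ A) → Connected ptˢ
      Connected⇒Connectedˢ = Connected-transport point (λ _ _ → refl) (proj₁ ∘ index) (proj₂ ∘ index)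

      Connectedˢ⇒Connected : Connected ptˢ → Connected (ptⱽ A)
      Connectedˢ⇒Connected = Connected-transport (proj₁ ∘ index) (proj₂ ∘ index) point (λ _ _ → refl)

enumeration-injective : ∀ {n m S} (A : Vec (Vec ℤ n) m) → Enumerates S A →
                        ∀ i j → (∀ k → ptⱽ A i k ≡ ptⱽ A j k) → i ≡ j
enumeration-injective A enum i j e = proj₁ enum i j (lookup-ext e)

theorem1p2 : ∀ {c ℓ : Level} (K : Field c ℓ) (n k : ℕ) (vs : Vec (Vec ℤ n) k) →
    AntiBlocking vs → FullDimensional vs →
    ∀ (m : ℕ) (A : Vec (Vec ℤ n) m) → Enumerates (LatticePointOf vs) A →
    ∀ (m± : ℕ) (B : Vec (Vec ℤ n) m±) → Enumerates (LatticePointOf± vs) B →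
    (GeneratedByQuadraticBinomials K A → GeneratedByQuadraticBinomials K B) ×
    (GeneratedByQuadraticBinomials K B → GeneratedByQuadraticBinomials K A)
theorem1p2 K n k vs anti _ m A enumA m± B enumB =
  (Toric.connected⇒generated K B (enumeration-injective B enumB)
    ∘ Connectedˢ⇒Connected vs anti B enumB ∘ Connectedᴾ⇒Connectedˢ ∘ Connected⇒Connectedᴾ vs anti A enumA
    ∘ Toric.generated⇒connected K A) ,
  (Toric.connected⇒generated K A (enumeration-injective A enumA)
    ∘ Connectedᴾ⇒Connected vs anti A enumA ∘ Connectedˢ⇒Connectedᴾ ∘ Connected⇒Connectedˢ vs anti B enumB
    ∘ Toric.generated⇒connected K B)
  where open DownClosed (T vs anti) (T-down vs anti)
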